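{- Let $D$ be a digraph of order $p\geq 5$ such that $d(x)=id(x)+od(x)\geq p-1$ for every vertex $x$, and $\min\{id(x),od(x)\}\geq p/2-1$ for every vertex $x$. Put $n:=\lfloor p/2\rfloor$. Then: (i) either $D$ contains a directed cycle of length $3$, or $D\in \mathcal{B}(n,n)\cup\{Q_5^*,\,K_{n,n+1}^*\}$; (ii) either $D$ contains a directed cycle of length $4$, or $D\in \mathcal{H}(3,3)\cup\{Q_5^*,\,H'_6,\,H''_6,\,H'''_6,\,[(K_2\cup K_2)+K_1]^*\}$. (Membership is up to isomorphism.)
   Context: Digraphs are finite, without loops and without multiple arcs, but may contain both arcs $xy$ and $yx$ (a cycle of length 2). For a vertex $x$, $O(x)$ and $I(x)$ are its out- and in-neighbourhoods, $od(x)=|O(x)|$, $id(x)=|I(x)|$, $d(x)=od(x)+id(x)$. Cycles are directed and simple. For an undirected graph $G$, $G^*$ denotes the symmetric digraph obtained by replacing each edge $xy$ by the two arcs $xy,yx$. $K_m$ is the complete graph, $K_{a,b}$ the complete bipartite graph, $Q_k$ the undirected cycle of length $k$; $G_1\cup G_2$ is disjoint union and $G_1+G_2$ is the join. $K_m^*$ is thus the complete symmetric digraph on $m$ vertices. $\mathcal{B}(n,n)$: the set of digraphs of order $2n\geq 6$ obtained from $K^*_{n,n}$ by deleting $k$ pairwise vertex-disjoint arcs, where $0\leq k\leq n$. $\mathcal{H}(n,n)$ (for $n\geq1$): the set of digraphs $D$ of order $2n$ with $V(D)=F\cup B$, $|F|=|B|=n$, $D[F]$ and $D[B]$ both complete symmetric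 digraphs $K_n^*$, no arc from a vertex of $B$ to a vertex of $F$, every vertex of $F$ has an out-neighbour in $B$ and every vertex of $B$ has an in-neighbour in $F$. $H'_6$: with $Q_6$ the undirected cycle $xvwuyzx$, the digraph obtained from $Q_6^*$ by adding the arcs $xy, xw, zu, vu$. $H''_6$: the digraph obtained from the directed cycle $xyvzwux$ by adding the arcs $xv, vx, xu, xw, uz, yu, yz, zy, wz, wv$. $H'''_6$: the digraph obtained from the directed cycle $xwvzyux$ by adding the arcs $xy, yv, vx, uz, zw, wu, xu, yz, vw$. -}

module Defs where

open import Data.Nat using (ℕ; zero; suc; _+_; _≡ᵇ_; _<ᵇ_)
open import Data.Bool using (Bool; true; false; if_then_else_; _∧_; _∨_; not; _xor_)
open import Data.Fin using (Fin; toℕ; _≟_)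
  renaming (zero to fzero; suc to fsuc)
open import Data.List using (List; []; _∷_; map; _++_)
open import Data.Bool.ListAction using (any)
open import Data.Product using (_×_; _,_; Σ; ∃; ∃-syntax)
open import Data.Sum using (_⊎_)
open import Relation.Binary.PropositionalEquality using (_≡_; _≢_; refl)
open import Relation.Nullary using (yes; no)

record Digraph (p : ℕ) : Set where
  field
    arc    : Fin p → Fin p → Bool
    noLoop : ∀ x → arc x x ≡ false
open Digraph public

loopless : ∀ {p} → (Fin p → Fin p → Bool) → Digraph p
loopless {p} f = record { arc = a ; noLoop = nl }
  where
  a : Fin p → Fin p → Bool
  a x y with x ≟ y
  ... | yes _ = false
  ... | no  _ = f x y
  nl : ∀ x → a x x ≡ false
  nl x with x ≟ x
  ... | yes _ = refl
  ... | no  q with q refl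
  ... | ()

count : ∀ {n} → (Fin n → Bool) → ℕ
count {zero}  f = 0
count {suc n} f = (if f fzero then 1 else 0) + count (λ i → f (fsuc i))

outdeg indeg : ∀ {p} → Digraph p → Fin p → ℕ
outdeg D x = count (λ y → arc D x y)
indeg  D x = count (λ y → arc D y x)

record _≅_ {p q : ℕ} (D : Digraph p) (E : Digraph q) : Set where
  field
    to       : Fin p → Fin q
    from     : Fin q → Fin p
    from∘to  : ∀ x → from (to x) ≡ x
    to∘from  : ∀ y → to (from y) ≡ y
    preserve : ∀ x y → arc D x y ≡ arc E (to x) (to y)

HasC3 : ∀ {p} → Digraph p → Set
HasC3 {p} D = Σ (Fin p) λ a → Σ (Fin p) λ b → Σ (Fin p) λ c →
  (a ≢ b) × (b ≢ c) × (a ≢ c) ×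
  (arc D a b ≡ true) × (arc D b c ≡ true) × (arc D c a ≡ true)

HasC4 : ∀ {p} → Digraph p → Set
HasC4 {p} D = Σ (Fin p) λ a → Σ (Fin p) λ b → Σ (Fin p) λ c → Σ (Fin p) λ d →
  (a ≢ b) × (a ≢ c) × (a ≢ d) × (b ≢ c) × (b ≢ d) × (c ≢ d) ×
  (arc D a b ≡ true) × (arc D b c ≡ true) × (arc D c d ≡ true) × (arc D d a ≡ true)

inList : ∀ {p} → List (ℕ × ℕ) → Fin p → Fin p → Bool
inList l x y = any (λ { (a , b) → (toℕ x ≡ᵇ a) ∧ (toℕ y ≡ᵇ b) }) l

fromArcs : (p : ℕ) → List (ℕ × ℕ) → Digraph p
fromArcs p l = loopless (inList {p} l)

symArcs : List (ℕ × ℕ) → List (ℕ × ℕ)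
symArcs l = l ++ map (λ { (a , b) → (b , a) }) l

fromEdges : (p : ℕ) → List (ℕ × ℕ) → Digraph p
fromEdges p l = fromArcs p (symArcs l)

Q5* : Digraph 5
Q5* = fromEdges 5 ((0 , 1) ∷ (1 , 2) ∷ (2 , 3) ∷ (3 , 4) ∷ (4 , 0) ∷ [])

K2K2K1* : Digraph 5
K2K2K1* = fromEdges 5 ((0 , 1) ∷ (2 , 3) ∷ (4 , 0) ∷ (4 , 1) ∷ (4 , 2) ∷ (4 , 3) ∷ [])

Kstar : (a b : ℕ) → Digraph (a + b)
Kstar a b = loopless (λ x y → (toℕ x <ᵇ a) xor (toℕ y <ᵇ a))

-- H'_6 : x=0, v=1, w=2, u=3, y=4, z=5;  Q_6 = x v w u y z x
H'6 : Digraph 6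
H'6 = fromArcs 6
  (symArcs ((0 , 1) ∷ (1 , 2) ∷ (2 , 3) ∷ (3 , 4) ∷ (4 , 5) ∷ (5 , 0) ∷ [])
   ++ ((0 , 4) ∷ (0 , 2) ∷ (5 , 3) ∷ (1 , 3) ∷ []))

-- H''_6 : x=0, y=1, v=2, z=3, w=4, u=5; directed cycle x y v z w u x
H''6 : Digraph 6
H''6 = fromArcs 6
  ((0 , 1) ∷ (1 , 2) ∷ (2 , 3) ∷ (3 , 4) ∷ (4 , 5) ∷ (5 , 0) ∷
   (0 , 2) ∷ (2 , 0) ∷ (0 , 5) ∷ (0 , 4) ∷ (5 , 3) ∷ (1 , 5) ∷ (1 , 3) ∷
   (3 , 1) ∷ (4 , 3) ∷ (4 , 2) ∷ [])

-- H'''_6 : x=0, w=1, v=2, z=3, y=4, u=5; directed cycle x w v z y u x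
H'''6 : Digraph 6
H'''6 = fromArcs 6
  ((0 , 1) ∷ (1 , 2) ∷ (2 , 3) ∷ (3 , 4) ∷ (4 , 5) ∷ (5 , 0) ∷
   (0 , 4) ∷ (4 , 2) ∷ (2 , 0) ∷ (5 , 3) ∷ (3 , 1) ∷ (1 , 5) ∷ (0 , 5) ∷
   (4 , 3) ∷ (2 , 1) ∷ [])

DisjointArcsOf : ∀ {p} → Digraph p → (Fin p → Fin p → Bool) → Set
DisjointArcsOf {p} K M =
  (∀ x y → M x y ≡ true → arc K x y ≡ true) ×
  (∀ x y u v → M x y ≡ true → M u v ≡ true →
     (x ≡ u × y ≡ v) ⊎ (x ≢ u × x ≢ v × y ≢ u × y ≢ v))

deleteArcs : ∀ {p} → (D : Digraph p) → (Fin p → Fin p → Bool) → Digraph p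
deleteArcs D M = record
  { arc    = λ x y → arc D x y ∧ not (M x y)
  ; noLoop = λ x → lemma (arc D x x) (M x x) (noLoop D x) }
  where
  lemma : ∀ a m → a ≡ false → (a ∧ not m) ≡ false
  lemma false m refl = refl

InB : (n : ℕ) → ∀ {p} → Digraph p → Set
InB n D = (3 Data.Nat.≤ n) ×
  Σ (Fin (n + n) → Fin (n + n) → Bool) λ M →
    DisjointArcsOf (Kstar n n) M × (D ≅ deleteArcs (Kstar n n) M)

-- The family H(n,n) (closed under isomorphism, so defined intrinsically):
-- V = F ∪ B (F = vertices with inF true), |F| = |B| = n, D[F], D[B]
-- complete symmetric, no arc B → F, each vertex of F has an out-neighbour
-- in B and each vertex of B has an in-neighbour in F.

InH : (n : ℕ) → ∀ {p} → Digraph p → Set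
InH n {p} D = Σ (Fin p → Bool) λ inF →
  (count inF ≡ n) × (count (λ x → not (inF x)) ≡ n) ×
  (∀ x y → x ≢ y → inF x ≡ inF y → arc D x y ≡ true) ×
  (∀ x y → inF x ≡ false → inF y ≡ true → arc D x y ≡ false) ×
  (∀ x → inF x ≡ true → Σ (Fin p) λ y → (inF y ≡ false) × (arc D x y ≡ true)) ×
  (∀ y → inF y ≡ false → Σ (Fin p) λ x → (inF x ≡ true) × (arc D x y ≡ true))

-- For an arc a → b without reverse, compare O(b) with I(a): if the forbidden cycle is absent,
-- these sets satisfy counting constraints so tight that 2 id(a) + 2 = p = 2 od(b) + 2.
-- Since d(x) ≥ p − 1, no vertex is both such an a and such a b, so the symmetric arcs alone form an
-- undirected graph in which every degree is at least p/2 − 1.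
--
-- Cycles of length 4, p ≥ 7: an undirected graph with these degrees contains a 4-cycle, because any
-- three neighbours of a vertex span an edge and such an edge forces more than p vertices.
--
-- Cycles of length 3, p ≥ 6: without a triangle D is bipartite.  If u → t is asymmetric, the classes
-- are {u} ∪ O(t) and {t} ∪ I(u); if all arcs are symmetric, they are O(u) and O(v) for any edge uv.
-- The degree conditions then leave only K*(n,n+1), or K*(n,n) with at most one arc missing per vertex.
--
-- The orders 5 and 6 that remain are settled by a verified exhaustive search.  For p = 6 a triangle
-- may be assumed, as a bipartite D has a 4-cycle; it is moved to 0 → 1 → 2 → 0 to shrink the search.

module Submission where

open import Defs
open import Data.Nat as ℕ using (ℕ; zero; suc; _+_; _*_; _∸_; _≤_; _<_; z≤n; s≤s; _≤?_; _<ᵇ_; _/_)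
open import Data.Nat.Properties hiding (_≟_; _≤?_)
open import Data.Nat.DivMod using (m*n/n≡m; +-distrib-/-∣ˡ)
open import Data.Nat.Divisibility using (divides)
open import Data.Bool using (Bool; true; false; if_then_else_; _∧_; _∨_; not; _xor_; T)
import Data.Bool.Properties as Bool
open import Data.Bool.ListAction using (any; all)
open import Data.Fin using (Fin; _≟_; toℕ; splitAt; join) renaming (zero to fzero; suc to fsuc)
open import Data.Fin.Patterns using (0F; 1F; 2F)
open import Data.Fin.Permutation
  using (Permutation′; permutation; _⟨$⟩ʳ_; _⟨$⟩ˡ_; inverseˡ; inverseʳ; transpose; _∘ₚ_) renaming (id to idₚ)
open import Data.Fin.Properties using (any?; all?; splitAt-join; join-splitAt; toℕ-↑ˡ; toℕ-↑ʳ; toℕ<n)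
open import Algebra.Properties.CommutativeMonoid.Sum +-0-commutativeMonoid using (sum; sum-permute)
open import Data.Maybe using (Maybe; just; nothing)
open import Data.Maybe.Properties using (just-injective)
open import Data.Vec using (Vec; lookup; tabulate; updateAt)
open import Data.Vec.Properties using (lookup∘tabulate; lookup∘updateAt; lookup∘updateAt′)
open import Data.Product using (Σ; ∃-syntax; _×_; _,_; proj₁; proj₂)
open import Data.Sum as Sum using (_⊎_; inj₁; inj₂; [_,_])
open import Data.Empty using (⊥; ⊥-elim)
open import Function using (_∘_; const; Equivalence)
open import Relation.Nullary using (¬_; Dec; yes; no; does)
open import Relation.Nullary.Decidable using (dec-true; dec-false; _×-dec_; _→-dec_; map′; ¬?; decidable-stable)
open import Relation.Binary.Definitions using (tri<; tri≈; tri>)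
open import Relation.Binary.PropositionalEquality hiding ([_])

-- Linear inequalities between degrees, set sizes and the order.

module Arithmetic where

  open import Data.List using ([]; _∷_)
  open import Data.Nat.Tactic.RingSolver using (solve)

  infixr 6 _⊕_
  _⊕_ : ∀ {a b c d} → a ≤ b → c ≤ d → a + c ≤ b + d
  _⊕_ = +-mono-≤

  overshoot : ∀ {m n} k → m ≤ n → m ≡ suc (n + k) → ⊥
  overshoot {n = n} k m≤n refl = <-irrefl refl (≤-trans (s≤s (m≤m+n n k)) m≤n)

  -- The inequalities below are refuted by adding up hypotheses, with suitable multiplicities, until
  -- the left-hand side exceeds the right-hand side by k + 1.
  abstract
    common-nonempty : ∀ p o i a f → p ≤ 2 * o + 2 → p ≤ 2 * i + 2 → 3 ≤ a → o + i + a ≤ p + f → 0 < f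
    common-nonempty p o i a zero    po pi 3≤a h =
      ⊥-elim (overshoot 1 (po ⊕ pi ⊕ 3≤a ⊕ 3≤a ⊕ h ⊕ h) (solve (p ∷ o ∷ i ∷ a ∷ [])))
    common-nonempty p o i a (suc f) po pi 3≤a h = s≤s z≤n

    commons-not-both-≤1 : ∀ p o₁ i₁ o₂ i₂ a f g → p ≤ suc (i₁ + o₁) → p ≤ suc (i₂ + o₂) → 3 ≤ a →
      o₁ + i₂ + a ≤ p + f → o₂ + i₁ + a ≤ p + g → f ≤ 1 → g ≤ 1 → ⊥
    commons-not-both-≤1 p o₁ i₁ o₂ i₂ a f g t₁ t₂ 3≤a h k f≤1 g≤1 =
      overshoot 1 (t₁ ⊕ t₂ ⊕ 3≤a ⊕ 3≤a ⊕ h ⊕ k ⊕ f≤1 ⊕ g≤1)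
        (solve (p ∷ o₁ ∷ i₁ ∷ o₂ ∷ i₂ ∷ a ∷ f ∷ g ∷ []))

    isolate-first : ∀ b r i a → b + r + i + a ≡ (r + i + a + 0) + b
    isolate-first b r i a = solve (b ∷ r ∷ i ∷ a ∷ [])

    both-large : ∀ p o i → p < 2 * i + 2 → p ≤ 2 * o + 2 → o + i + 2 ≤ p → ⊥
    both-large p o i h k l = overshoot 0 (h ⊕ k ⊕ l ⊕ l) (solve (p ∷ o ∷ i ∷ []))

    degree≥3 : ∀ p d → 7 ≤ p → p ≤ 2 * d + 2 → 3 ≤ d
    degree≥3 p d 7≤p h = ≮⇒≥ λ (d<3 : d < 3) → overshoot 0 (7≤p ⊕ h ⊕ d<3 ⊕ d<3) (solve (p ∷ d ∷ []))

    disjoint-thirds : ∀ p d₁ d₂ d₃ n₁ n₂ n₃ → 5 ≤ p → p ≤ 2 * d₁ + 2 → p ≤ 2 * d₂ + 2 → p ≤ 2 * d₃ + 2 →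
      d₁ ≤ suc n₁ → d₂ ≤ suc n₂ → d₃ ≤ suc n₃ → n₁ + n₂ + n₃ + 4 ≤ p → ⊥
    disjoint-thirds p d₁ d₂ d₃ n₁ n₂ n₃ 5≤p a b c d e f h =
      overshoot 0 (5≤p ⊕ a ⊕ b ⊕ c ⊕ d ⊕ d ⊕ e ⊕ e ⊕ f ⊕ f ⊕ h ⊕ h)
        (solve (p ∷ d₁ ∷ d₂ ∷ d₃ ∷ n₁ ∷ n₂ ∷ n₃ ∷ []))

    almost-disjoint-halves : ∀ p d₁ d₂ n₁ n₂ u i → p ≤ 2 * d₁ + 2 → p ≤ 2 * d₂ + 2 →
      d₁ ≤ suc n₁ → d₂ ≤ suc n₂ → n₁ + n₂ ≡ u + i → u + 6 ≤ p → i ≤ 1 → ⊥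
    almost-disjoint-halves p d₁ d₂ n₁ n₂ u i a b c d e f g =
      overshoot 1 (a ⊕ b ⊕ c ⊕ c ⊕ d ⊕ d ⊕ ≤-reflexive e ⊕ ≤-reflexive e ⊕ f ⊕ f ⊕ g ⊕ g)
        (solve (p ∷ d₁ ∷ d₂ ∷ n₁ ∷ n₂ ∷ u ∷ i ∷ []))

    deficient : ∀ p i o → p ≤ suc (i + o) → 2 * i + 2 ≤ p → 2 * o + 2 ≤ p → ⊥
    deficient p i o a b c = overshoot 1 (a ⊕ a ⊕ b ⊕ c) (solve (p ∷ i ∷ o ∷ []))

    uncovered : ∀ p i o → p ≤ 2 * i + 2 → p ≤ 2 * o + 2 → o + i + 3 ≤ p → ⊥
    uncovered p i o a b c = overshoot 1 (a ⊕ b ⊕ c ⊕ c) (solve (p ∷ i ∷ o ∷ []))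

    degree≥2 : ∀ p d → 6 ≤ p → p ≤ 2 * d + 2 → 2 ≤ d
    degree≥2 p d a b = ≮⇒≥ λ (d<2 : d < 2) → overshoot 1 (a ⊕ b ⊕ d<2 ⊕ d<2) (solve (p ∷ d ∷ []))

    half≥3 : ∀ p d → 6 ≤ p → p ≤ suc (d + d) → 3 ≤ d
    half≥3 p d a b = ≮⇒≥ λ (d<3 : d < 3) → overshoot 0 (a ⊕ b ⊕ d<3 ⊕ d<3) (solve (p ∷ d ∷ []))

    two-uncovered : ∀ p d₁ d₂ → p ≤ suc (d₁ + d₁) → p ≤ suc (d₂ + d₂) → d₁ + d₂ + 2 ≤ p → ⊥
    two-uncovered p d₁ d₂ a b c = overshoot 1 (a ⊕ b ⊕ c ⊕ c) (solve (p ∷ d₁ ∷ d₂ ∷ []))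

    remainder≤1 : ∀ p d₁ d₂ r → p ≤ suc (d₁ + d₁) → p ≤ suc (d₂ + d₂) → d₁ + d₂ + r + 0 ≤ p → r ≤ 1
    remainder≤1 p d₁ d₂ r a b c = ≮⇒≥ λ (1<r : 1 < r) →
      overshoot 1 (a ⊕ b ⊕ c ⊕ c ⊕ 1<r ⊕ 1<r) (solve (p ∷ d₁ ∷ d₂ ∷ r ∷ []))

    class-size : ∀ p i o c → p ≤ suc (i + o) → i ≤ c → o ≤ c → p ≤ suc (c + c)
    class-size p i o c h i≤c o≤c = ≤-trans h (s≤s (i≤c ⊕ o≤c))

    balance : ∀ p a b → a + b ≡ p → p ≤ suc (a + a) → p ≤ suc (b + b) → a ≡ b ⊎ b ≡ suc a ⊎ a ≡ suc b
    balance _ a b refl h k with +-cancelˡ-≤ a b (suc a) (subst (a + b ≤_) (sym (+-suc a a)) h)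
                       | +-cancelʳ-≤ b a (suc b) k
    ... | b≤ | a≤ with <-cmp a b
    ...   | tri≈ _ a≡b _ = inj₁ a≡b
    ...   | tri< a<b _ _ = inj₂ (inj₁ (≤-antisym b≤ a<b))
    ...   | tri> _ _ b<a = inj₂ (inj₂ (≤-antisym a≤ b<a))

    one-missing : ∀ p d a → p ≡ a + suc a → p ≤ 2 * d + 2 → d + 1 ≤ a → ⊥
    one-missing p d a e h k = overshoot 0 (≤-reflexive (sym e) ⊕ h ⊕ k ⊕ k) (solve (p ∷ d ∷ a ∷ []))

    two-missing : ∀ p d a → p ≡ a + a → p ≤ 2 * d + 2 → d + 2 ≤ a → ⊥
    two-missing p d a e h k = overshoot 1 (≤-reflexive (sym e) ⊕ h ⊕ k ⊕ k) (solve (p ∷ d ∷ a ∷ []))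

    both-missing : ∀ p i o a → p ≡ a + a → p ≤ suc (i + o) → i + 1 ≤ a → o + 1 ≤ a → ⊥
    both-missing p i o a e h k l = overshoot 0 (≤-reflexive (sym e) ⊕ h ⊕ k ⊕ l) (solve (p ∷ i ∷ o ∷ a ∷ []))

    positive : ∀ p d → 3 ≤ p → p ≤ 2 * d + 2 → 0 < d
    positive p zero    a b = ⊥-elim (overshoot 0 (a ⊕ b) (solve (p ∷ [])))
    positive p (suc d) a b = s≤s z≤n

open Arithmetic

open import Data.List as List using (List; []; _∷_; length; allFin)
open import Data.List.Relation.Unary.All as All using (All; []; _∷_)
open import Data.List.Relation.Unary.AllPairs using ([]; _∷_)
open import Data.List.Relation.Unary.Unique.Propositional using (Unique)

-- Counting

true≢false : ∀ {b} → b ≡ true → b ≡ false → ⊥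
true≢false refl ()

≢true⇒≡false : ∀ {b} → (b ≡ true → ⊥) → b ≡ false
≢true⇒≡false {true}  h = ⊥-elim (h refl)
≢true⇒≡false {false} h = refl

∧-intro : ∀ {a b} → a ≡ true → b ≡ true → a ∧ b ≡ true
∧-intro refl refl = refl

∧-elim : ∀ {a b} → a ∧ b ≡ true → a ≡ true × b ≡ true
∧-elim {true} {true} _ = refl , refl

∨-elim : ∀ {a b} → a ∨ b ≡ true → a ≡ true ⊎ b ≡ true
∨-elim {true} _ = inj₁ refl
∨-elim {false} h = inj₂ h

∨-false : ∀ {a b} → a ≡ false → b ≡ false → a ∨ b ≡ false
∨-false refl refl = refl

not-true : ∀ {b} → not b ≡ true → b ≡ false
not-true {false} _ = refl

private
  variable
    n : ℕ

_∪_ _∩_ _∖_ : (Fin n → Bool) → (Fin n → Bool) → Fin n → Bool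
(f ∪ g) x = f x ∨ g x
(f ∩ g) x = f x ∧ g x
(f ∖ g) x = f x ∧ not (g x)

⁅_⁆ : Fin n → Fin n → Bool
⁅ y ⁆ x = does (x ≟ y)

⁅⁆-self : (y : Fin n) → ⁅ y ⁆ y ≡ true
⁅⁆-self y = dec-true (y ≟ y) refl

⁅⁆-other : {x y : Fin n} → x ≢ y → ⁅ y ⁆ x ≡ false
⁅⁆-other {x = x} {y} x≢y = dec-false (x ≟ y) x≢y

⁅⁆-elim : {x y : Fin n} → ⁅ y ⁆ x ≡ true → x ≡ y
⁅⁆-elim {x = x} {y} h with x ≟ y
... | yes x≡y = x≡y

count-mono : (f g : Fin n → Bool) → (∀ x → f x ≡ true → g x ≡ true) → count f ≤ count g
count-mono {zero} f g f⊆g = z≤n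
count-mono {suc n} f g f⊆g with f fzero in fe | g fzero in ge
... | true  | true  = s≤s (count-mono _ _ (f⊆g ∘ fsuc))
... | true  | false = ⊥-elim (true≢false (f⊆g fzero fe) ge)
... | false | true  = m≤n⇒m≤1+n (count-mono _ _ (f⊆g ∘ fsuc))
... | false | false = count-mono _ _ (f⊆g ∘ fsuc)

count-cong : (f g : Fin n → Bool) → (∀ x → f x ≡ g x) → count f ≡ count g
count-cong f g f≗g = ≤-antisym (count-mono f g λ x h → trans (sym (f≗g x)) h)
                               (count-mono g f λ x h → trans (f≗g x) h)

count-∪-∩ : (f g : Fin n → Bool) → count f + count g ≡ count (f ∪ g) + count (f ∩ g)
count-∪-∩ {zero}  f g = refl
count-∪-∩ {suc n} f g with f fzero | g fzero | count-∪-∩ (f ∘ fsuc) (g ∘ fsuc)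
... | true  | true  | ih = cong suc (trans (+-suc _ _) (trans (cong suc ih) (sym (+-suc _ _))))
... | true  | false | ih = cong suc ih
... | false | true  | ih = trans (+-suc _ _) (cong suc ih)
... | false | false | ih = ih

count-empty : (f : Fin n → Bool) → (∀ x → f x ≡ false) → count f ≡ 0
count-empty {zero}  f e = refl
count-empty {suc n} f e rewrite e fzero = count-empty (f ∘ fsuc) (e ∘ fsuc)

count-full : (n : ℕ) → count {n} (λ _ → true) ≡ n
count-full zero    = refl
count-full (suc n) = cong suc (count-full n)

count≤n : (f : Fin n → Bool) → count f ≤ n
count≤n {n} f = subst (count f ≤_) (count-full n) (count-mono f (λ _ → true) λ _ _ → refl)

Disjoint : (f g : Fin n → Bool) → Set
Disjoint f g = ∀ x → f x ≡ true → g x ≡ true → ⊥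

count-⊎ : (f g : Fin n → Bool) → Disjoint f g → count f + count g ≡ count (f ∪ g)
count-⊎ f g dis = begin
  count f + count g             ≡⟨ count-∪-∩ f g ⟩
  count (f ∪ g) + count (f ∩ g) ≡⟨ cong (count (f ∪ g) +_) (count-empty (f ∩ g) λ x → ≢true⇒≡false λ h → let a , b = ∧-elim h in dis x a b) ⟩
  count (f ∪ g) + 0             ≡⟨ +-identityʳ _ ⟩
  count (f ∪ g)                 ∎
  where open ≡-Reasoning

count-split : (f g : Fin n → Bool) → count f ≡ count (f ∩ g) + count (f ∖ g)
count-split f g = sym (trans
  (count-⊎ (f ∩ g) (f ∖ g) λ x a b → true≢false (proj₂ (∧-elim {f x} a)) (not-true (proj₂ (∧-elim {f x} b))))
  (count-cong ((f ∩ g) ∪ (f ∖ g)) f λ x → pointwise (f x) (g x)))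
  where
  pointwise : ∀ a b → a ∧ b ∨ a ∧ not b ≡ a
  pointwise true  true  = refl
  pointwise true  false = refl
  pointwise false _     = refl

count-complement : (f : Fin n → Bool) → count f + count (not ∘ f) ≡ n
count-complement {n} f = trans (sym (count-split (λ _ → true) f)) (count-full n)

count-⁅⁆ : (y : Fin n) → count ⁅ y ⁆ ≡ 1
count-⁅⁆ {suc n} fzero    = cong suc (count-empty {n} (λ _ → false) λ _ → refl)
count-⁅⁆ {suc n} (fsuc y) = trans (count-cong (⁅ fsuc y ⁆ ∘ fsuc) ⁅ y ⁆ suc-⁅⁆) (count-⁅⁆ y)
  where
  suc-⁅⁆ : ∀ x → ⁅ fsuc y ⁆ (fsuc x) ≡ ⁅ y ⁆ x
  suc-⁅⁆ x with x ≟ y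
  ... | yes _ = refl
  ... | no  _ = refl

-- Each listed vertex is adjoined to the set, which raises the count by one and shortens the list by
-- one, until only a subset of `Fin n` is left. Nearly every counting argument below takes this
-- form: sets of neighbours together with a few vertices outside them cannot exceed p.
count-avoid : (f : Fin n → Bool) {ys : List (Fin n)} → Unique ys → All (λ y → f y ≡ false) ys →
  count f + length ys ≤ n
count-avoid {n} f [] [] = subst (_≤ n) (sym (+-identityʳ _)) (count≤n f)
count-avoid {n} f {y ∷ ys} (y∉ys ∷ u) (fy ∷ fys) =
  subst (_≤ n) size (count-avoid (f ∪ ⁅ y ⁆) u
    (All.zipWith (λ (y≢z , fz) → ∨-false fz (⁅⁆-other (y≢z ∘ sym))) (y∉ys , fys)))
  where
  size : count (f ∪ ⁅ y ⁆) + length ys ≡ count f + suc (length ys)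
  size = trans (cong (_+ length ys) (trans
      (sym (count-⊎ f ⁅ y ⁆ λ x fx x≡y → true≢false (subst (λ z → f z ≡ true) (⁅⁆-elim x≡y) fx) fy))
      (cong (count f +_) (count-⁅⁆ y))))
    (+-assoc (count f) 1 (length ys))

count-avoid₂ : (f g : Fin n → Bool) {ys : List (Fin n)} → Disjoint f g → Unique ys →
  All (λ y → f y ≡ false × g y ≡ false) ys → count f + count g + length ys ≤ n
count-avoid₂ {n} f g {ys} dis u a = subst (λ k → k + length ys ≤ n) (sym (count-⊎ f g dis))
  (count-avoid (f ∪ g) u (All.map (λ (p , q) → ∨-false p q) a))

count-avoid₃ : (f g h : Fin n → Bool) {ys : List (Fin n)} → Disjoint f g → Disjoint f h → Disjoint g h →
  Unique ys → All (λ y → f y ≡ false × g y ≡ false × h y ≡ false) ys →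
  count f + count g + count h + length ys ≤ n
count-avoid₃ {n} f g h {ys} fg fh gh u a = subst (λ k → k + count h + length ys ≤ n) (sym (count-⊎ f g fg))
  (count-avoid₂ (f ∪ g) h (λ x p q → [ (λ r → fh x r q) , (λ r → gh x r q) ] (∨-elim p)) u
    (All.map (λ (p , q , r) → ∨-false p q , r) a))

count-remove : (f : Fin n → Bool) (y : Fin n) → count f ≤ suc (count (f ∖ ⁅ y ⁆))
count-remove f y = subst (_≤ suc (count (f ∖ ⁅ y ⁆))) (sym (count-split f ⁅ y ⁆))
  (+-monoˡ-≤ (count (f ∖ ⁅ y ⁆))
    (subst (count (f ∩ ⁅ y ⁆) ≤_) (count-⁅⁆ y) (count-mono (f ∩ ⁅ y ⁆) ⁅ y ⁆ λ x → proj₂ ∘ ∧-elim {f x})))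

∖-elim : (f : Fin n → Bool) {x y : Fin n} → (f ∖ ⁅ y ⁆) x ≡ true → f x ≡ true × x ≢ y
∖-elim f {x} h = proj₁ (∧-elim h) ,
  λ { refl → true≢false (⁅⁆-self x) (not-true (proj₂ (∧-elim {f x} h))) }

-- Removing one vertex of `ys` lowers the count by at most one, so something remains after all of
-- `ys` is removed.
pick : (f : Fin n → Bool) (ys : List (Fin n)) → length ys < count f →
  ∃[ x ] f x ≡ true × All (x ≢_) ys
pick {suc n} f [] 0<c with f fzero in e
... | true  = fzero , e , []
... | false with pick (f ∘ fsuc) [] 0<c
...   | x , fx , _ = fsuc x , fx , []
pick f (y ∷ ys) len< with pick (f ∖ ⁅ y ⁆) ys (+-cancelˡ-≤ 1 _ _ (≤-trans len< (count-remove f y)))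
... | x , fx , x∉ys = let fx , x≢y = ∖-elim f fx in x , fx , x≢y ∷ x∉ys

pick₂ : (f : Fin n → Bool) → 2 ≤ count f → ∃[ x ] ∃[ y ] x ≢ y × f x ≡ true × f y ≡ true
pick₂ f 2≤ with pick f [] (≤-trans (s≤s z≤n) 2≤)
... | x , fx , _ with pick f (x ∷ []) 2≤
...   | y , fy , y≢x ∷ [] = x , y , ≢-sym y≢x , fx , fy

pick₃ : (f : Fin n → Bool) → 3 ≤ count f →
  ∃[ x ] ∃[ y ] ∃[ z ] (x ≢ y × x ≢ z × y ≢ z) × f x ≡ true × f y ≡ true × f z ≡ true
pick₃ f 3≤ with pick₂ f (≤-trans (s≤s (s≤s z≤n)) 3≤)
... | x , y , x≢y , fx , fy with pick f (x ∷ y ∷ []) 3≤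
...   | z , fz , z≢x ∷ z≢y ∷ [] = x , y , z , (x≢y , ≢-sym z≢x , ≢-sym z≢y) , fx , fy , fz

-- Cycles of length 4 for p ≥ 7

-- The degree hypotheses, without halves or truncated subtraction: p - 1 ≤ id + od, and p/2 - 1 as a
-- bound on each of id and od.
record Dense {p : ℕ} (D : Digraph p) : Set where
  field
    total≥ : ∀ x → p ≤ suc (indeg D x + outdeg D x)
    in≥    : ∀ x → p ≤ 2 * indeg D x + 2
    out≥   : ∀ x → p ≤ 2 * outdeg D x + 2
open Dense

converse : ∀ {p} → Digraph p → Digraph p
converse D = record { arc = λ x y → arc D y x ; noLoop = noLoop D }

converse-dense : ∀ {p} {D : Digraph p} → Dense D → Dense (converse D)
converse-dense {p} {D} dense = record
  { total≥ = λ x → subst (λ k → p ≤ suc k) (+-comm (indeg D x) (outdeg D x)) (total≥ dense x)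
  ; in≥    = out≥ dense
  ; out≥   = in≥ dense
  }

module _ {p : ℕ} (D : Digraph p) where

  arc⇒≢ : ∀ {x y} → arc D x y ≡ true → x ≢ y
  arc⇒≢ xy refl = true≢false xy (noLoop D _)

  ≢-arcˡ : ∀ {x y z} → arc D x z ≡ true → arc D y z ≡ false → x ≢ y
  ≢-arcˡ xz yz refl = true≢false xz yz

  ≢-arcʳ : ∀ {x y z} → arc D z x ≡ true → arc D z y ≡ false → x ≢ y
  ≢-arcʳ zx zy refl = true≢false zx zy

  triangle : ∀ {a b c} → arc D a b ≡ true → arc D b c ≡ true → arc D c a ≡ true → HasC3 D
  triangle ab bc ca = _ , _ , _ , arc⇒≢ ab , arc⇒≢ bc , (arc⇒≢ ca ∘ sym) , ab , bc , ca

  -- Consecutive vertices differ because there are no loops, which leaves only the two diagonals to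
  -- be compared.
  quadrangle : ∀ {a b c d} → a ≢ c → b ≢ d →
    arc D a b ≡ true → arc D b c ≡ true → arc D c d ≡ true → arc D d a ≡ true → HasC4 D
  quadrangle a≢c b≢d ab bc cd da =
    _ , _ , _ , _ , arc⇒≢ ab , a≢c , (arc⇒≢ da ∘ sym) , arc⇒≢ bc , b≢d , arc⇒≢ cd , ab , bc , cd , da

converse-C4 : ∀ {p} {D : Digraph p} → HasC4 (converse D) → HasC4 D
converse-C4 {D = D} (_ , _ , _ , _ , _ , a≢c , _ , _ , b≢d , _ , ab , bc , cd , da) =
  quadrangle D a≢c (b≢d ∘ sym) da cd bc ab

module _ {p : ℕ} {D : Digraph p} (dense : Dense D) where

  -- The sets O(s) minus I(t), I(t) and `A` are pairwise disjoint, so their sizes add up to at most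
  -- p. Adding |O(s) ∩ I(t)| to both sides restores |O(s)| on the left.
  common-neighbours : (A : Fin p → Bool) (s t : Fin p) →
    (∀ x → A x ≡ true → arc D s x ≡ false) → (∀ x → A x ≡ true → arc D x t ≡ false) →
    outdeg D s + indeg D t + count A ≤ p + count (λ x → arc D s x ∧ arc D x t)
  common-neighbours A s t s↛A A↛t = begin
      outdeg D s + indeg D t + count A                     ≡⟨ cong (λ k → k + indeg D t + count A) (count-split (arc D s) I) ⟩
      both + rest + indeg D t + count A                    ≡⟨ isolate-first both rest (indeg D t) (count A) ⟩
      (rest + indeg D t + count A + 0) + both              ≤⟨ +-monoˡ-≤ both (count-avoid₃ (arc D s ∖ I) I A
        (λ x p q → true≢false q (not-true (proj₂ (∧-elim {arc D s x} p))))
        (λ x p q → true≢false (proj₁ (∧-elim p)) (s↛A x q))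
        (λ x p q → true≢false p (A↛t x q)) [] []) ⟩
      p + both ∎
    where
    open ≤-Reasoning
    I : Fin p → Bool
    I x = arc D x t
    both rest : ℕ
    both = count (arc D s ∩ I)
    rest = count (arc D s ∖ I)

  Avoids : (Fin p → Bool) → Fin p → Set
  Avoids A s = ∀ x → A x ≡ true → arc D s x ≡ false × arc D x s ≡ false

  -- Counting gives distinct r ∈ O(s) ∩ I(t) and r′ ∈ O(t) ∩ I(s), as all neighbours of s and t lie outside A.
  quadrangle-through : (A : Fin p → Bool) {s t : Fin p} → s ≢ t → Avoids A s → Avoids A t →
    3 ≤ count A → HasC4 D
  quadrangle-through A {s} {t} s≢t sA tA 3≤A
    with 2 ≤? count (λ x → arc D t x ∧ arc D x s)
       | common-neighbours A s t (λ x → proj₁ ∘ sA x) (λ x → proj₂ ∘ tA x)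
       | common-neighbours A t s (λ x → proj₁ ∘ tA x) (λ x → proj₂ ∘ sA x)
  ... | yes 2≤g | st | ts
    with r  , fr , _        ← pick _ [] (common-nonempty p (outdeg D s) (indeg D t) _ _ (out≥ dense s) (in≥ dense t) 3≤A st)
    with r′ , gr , r′≢r ∷ _ ← pick _ (r ∷ []) 2≤g
    = quadrangle D s≢t (r′≢r ∘ sym) (proj₁ (∧-elim fr)) (proj₂ (∧-elim {arc D s r} fr))
        (proj₁ (∧-elim gr)) (proj₂ (∧-elim {arc D t r′} gr))
  -- The vertex picked second must avoid the first, so it comes from an intersection with at least
  -- two elements. If O(t) ∩ I(s) is too small, the total degrees of s and t force O(s) ∩ I(t) to be
  -- large enough.
  ... | no 2≰g | st | ts
    with r′ , gr , _        ← pick _ [] (common-nonempty p (outdeg D t) (indeg D s) _ _ (out≥ dense t) (in≥ dense s) 3≤A ts)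
    with r  , fr , r≢r′ ∷ _ ← pick _ (r′ ∷ []) (≰⇒> λ f≤1 → commons-not-both-≤1 p (outdeg D s) (indeg D s) (outdeg D t) (indeg D t) _ _ _
           (total≥ dense s) (total≥ dense t) 3≤A st ts f≤1 (≤-pred (≰⇒> 2≰g)))
    = quadrangle D s≢t r≢r′ (proj₁ (∧-elim fr)) (proj₂ (∧-elim {arc D s r} fr))
        (proj₁ (∧-elim gr)) (proj₂ (∧-elim {arc D t r′} gr))

  -- If c ∈ O(b) ∖ I(a) and there is no 4-cycle, then O(c) and I(a) are disjoint and both avoid a and c.
  O⊆I : ∀ {a b} → arc D a b ≡ true → arc D b a ≡ false → p < 2 * indeg D a + 2 →
    HasC4 D ⊎ (∀ c → arc D b c ≡ true → arc D c a ≡ true)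
  O⊆I {a} {b} ab b↛a p< with any? (λ c → (arc D b c Bool.≟ true) ×-dec (arc D c a Bool.≟ false))
  ... | no  none = inj₂ λ c bc → Bool.¬-not (λ ca → none (c , bc , ca))
  ... | yes (c , bc , c↛a) with any? (λ x → (arc D c x Bool.≟ true) ×-dec (arc D x a Bool.≟ true))
  ...   | yes (x , cx , xa) =
          inj₁ (quadrangle D (≢-arcʳ D bc b↛a ∘ sym) (≢-arcˡ D xa b↛a ∘ sym) ab bc cx xa)
  ...   | no  none = ⊥-elim (both-large p (outdeg D c) (indeg D a) p< (out≥ dense c)
          (count-avoid₂ (arc D c) (λ x → arc D x a) (λ x cx xa → none (x , cx , xa))
            ((≢-arcʳ D bc b↛a ∘ sym ∷ []) ∷ [] ∷ [])
            ((c↛a , noLoop D a) ∷ (noLoop D c , c↛a) ∷ [])))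

  -- By `O⊆I` every out-neighbour of b may be assumed to lead back to a. An arc s → t inside O(b)
  -- then gives the cycle a b s t. Without such an arc O(b) is independent with at least three
  -- vertices, and `quadrangle-through` applies to two of them with O(b) itself as the avoided set.
  C4-of-asymmetric : 7 ≤ p → ∀ {a b} → arc D a b ≡ true → arc D b a ≡ false →
    p < 2 * indeg D a + 2 → HasC4 D
  C4-of-asymmetric 7≤p {a} {b} ab b↛a p< with O⊆I ab b↛a p< | degree≥3 p _ 7≤p (out≥ dense b)
  ... | inj₁ c4  | _    = c4
  ... | inj₂ sub | 3≤od
    with any? (λ s → any? λ t → (arc D b s Bool.≟ true) ×-dec (arc D b t Bool.≟ true) ×-dec (arc D s t Bool.≟ true))
  ... | yes (s , t , bs , bt , st) =
          quadrangle D (≢-arcʳ D bs b↛a ∘ sym) (arc⇒≢ D bt) ab bs st (sub t bt)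
  ... | no independent
    with s , bs , _       ← pick (arc D b) [] (≤-trans (s≤s z≤n) 3≤od)
    with t , bt , t≢s ∷ _ ← pick (arc D b) (s ∷ []) (≤-trans (s≤s (s≤s z≤n)) 3≤od)
    = quadrangle-through (arc D b) t≢s (avoids t bt) (avoids s bs) 3≤od
    where
    avoids : ∀ s → arc D b s ≡ true → Avoids (arc D b) s
    avoids s bs x bx = ≢true⇒≡false (λ sx → independent (s , x , bs , bx , sx))
                     , ≢true⇒≡false (λ xs → independent (x , s , bx , bs , xs))

hasC3? : ∀ {p} (D : Digraph p) → Dec (HasC3 D)
hasC3? D = map′ (λ (_ , _ , _ , ab , bc , ca) → triangle D ab bc ca)
  (λ (_ , _ , _ , _ , _ , _ , arcs) → _ , _ , _ , arcs)
  (any? λ a → any? λ b → any? λ c →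
    (arc D a b Bool.≟ true) ×-dec (arc D b c Bool.≟ true) ×-dec (arc D c a Bool.≟ true))

hasC4? : ∀ {p} (D : Digraph p) → Dec (HasC4 D)
hasC4? D = map′ (λ (_ , _ , _ , _ , a≢c , b≢d , ab , bc , cd , da) → quadrangle D a≢c b≢d ab bc cd da)
  (λ (_ , _ , _ , _ , _ , a≢c , _ , _ , b≢d , _ , arcs) → _ , _ , _ , _ , a≢c , b≢d , arcs)
  (any? λ a → any? λ b → any? λ c → any? λ d → ¬? (a ≟ c) ×-dec ¬? (b ≟ d) ×-dec
    (arc D a b Bool.≟ true) ×-dec (arc D b c Bool.≟ true) ×-dec (arc D c d Bool.≟ true) ×-dec (arc D d a Bool.≟ true))

-- Undirected graphs of large minimum degree, and reduction to them.

Symmetric : ∀ {p} → Digraph p → Set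
Symmetric D = ∀ {x y} → arc D x y ≡ true → arc D y x ≡ true

module SymmetricC4Free {p : ℕ} (G : Digraph p) (symm : Symmetric G) (noC4 : ¬ HasC4 G) where

  private
    _~_ _≁_ : Fin p → Fin p → Set
    x ~ y = arc G x y ≡ true
    x ≁ y = arc G x y ≡ false

    others : Fin p → Fin p → Fin p → Bool
    others x y = arc G x ∖ ⁅ y ⁆

    ≁-sym : ∀ {x y} → x ≁ y → y ≁ x
    ≁-sym xy = ≢true⇒≡false λ yx → true≢false (symm yx) xy

    4-cycle : ∀ {a b c d} → a ≢ c → b ≢ d → a ~ b → b ~ c → c ~ d → d ~ a → ⊥
    4-cycle a≢c b≢d ab bc cd da = noC4 (quadrangle G a≢c b≢d ab bc cd da)

    remove-self : (f : Fin p → Bool) (y : Fin p) → (f ∖ ⁅ y ⁆) y ≡ false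
    remove-self f y = ≢true⇒≡false λ h → proj₂ (∖-elim f h) refl

    remove-≁ : (f : Fin p → Bool) {x y : Fin p} → f x ≡ false → (f ∖ ⁅ y ⁆) x ≡ false
    remove-≁ f fx rewrite fx = refl

  -- The sets N(uᵢ) ∖ {v} are disjoint and would avoid v, u₁, u₂, u₃: too many for p vertices.
  no-independent-triple : 5 ≤ p → (∀ x → p ≤ 2 * outdeg G x + 2) → ∀ {v u₁ u₂ u₃} →
    v ~ u₁ → v ~ u₂ → v ~ u₃ → u₁ ≢ u₂ → u₁ ≢ u₃ → u₂ ≢ u₃ → u₁ ≁ u₂ → u₁ ≁ u₃ → u₂ ≁ u₃ → ⊥
  no-independent-triple 5≤p deg≥ {v} {u₁} {u₂} {u₃} vu₁ vu₂ vu₃ u₁≢u₂ u₁≢u₃ u₂≢u₃ u₁≁u₂ u₁≁u₃ u₂≁u₃ =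
    disjoint-thirds p (outdeg G u₁) (outdeg G u₂) (outdeg G u₃) _ _ _ 5≤p (deg≥ u₁) (deg≥ u₂) (deg≥ u₃)
      (count-remove (arc G u₁) v) (count-remove (arc G u₂) v) (count-remove (arc G u₃) v)
      (count-avoid₃ (others u₁ v) (others u₂ v) (others u₃ v)
        (disjoint vu₁ vu₂ u₁≢u₂) (disjoint vu₁ vu₃ u₁≢u₃) (disjoint vu₂ vu₃ u₂≢u₃)
        ((arc⇒≢ G vu₁ ∷ arc⇒≢ G vu₂ ∷ arc⇒≢ G vu₃ ∷ []) ∷ (u₁≢u₂ ∷ u₁≢u₃ ∷ []) ∷ (u₂≢u₃ ∷ []) ∷ [] ∷ [])
        ( (remove-self (arc G u₁) v , remove-self (arc G u₂) v , remove-self (arc G u₃) v)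
        ∷ (remove-≁ (arc G u₁) (noLoop G u₁) , remove-≁ (arc G u₂) (≁-sym u₁≁u₂) , remove-≁ (arc G u₃) (≁-sym u₁≁u₃))
        ∷ (remove-≁ (arc G u₁) u₁≁u₂ , remove-≁ (arc G u₂) (noLoop G u₂) , remove-≁ (arc G u₃) (≁-sym u₂≁u₃))
        ∷ (remove-≁ (arc G u₁) u₁≁u₃ , remove-≁ (arc G u₂) u₂≁u₃ , remove-≁ (arc G u₃) (noLoop G u₃))
        ∷ []))
    where
    disjoint : ∀ {a b} → v ~ a → v ~ b → a ≢ b → Disjoint (others a v) (others b v)
    disjoint {a} {b} va vb a≢b x p q =
      let ax , x≢v = ∖-elim (arc G a) p ; bx , _ = ∖-elim (arc G b) q in
      4-cycle a≢b x≢v ax (symm bx) (symm vb) va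

  -- With new vertices w₁ ∈ N(u₁) and w₂ ∈ N(u₂), the sets N(w₁) ∖ {u₁} and N(u₃) ∖ {v} share at most
  -- one vertex and avoid v, u₁, u₂, u₃, w₁, w₂, so p ≥ 2 (p/2 − 2) − 1 + 6.
  no-triangle-with-pendant : (∀ x → p ≤ 2 * outdeg G x + 2) → (∀ x → 3 ≤ outdeg G x) → ∀ {v u₁ u₂ u₃} →
    v ~ u₁ → v ~ u₂ → v ~ u₃ → u₁ ≢ u₃ → u₂ ≢ u₃ → u₁ ~ u₂ → ⊥
  no-triangle-with-pendant deg≥ 3≤deg {v} {u₁} {u₂} {u₃} vu₁ vu₂ vu₃ u₁≢u₃ u₂≢u₃ u₁u₂
    with w₁ , u₁w₁ , w₁≢v ∷ w₁≢u₂ ∷ [] ← pick (arc G u₁) (v ∷ u₂ ∷ []) (3≤deg u₁)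
    with w₂ , u₂w₂ , w₂≢v ∷ w₂≢u₁ ∷ [] ← pick (arc G u₂) (v ∷ u₁ ∷ []) (3≤deg u₂)
    = almost-disjoint-halves p (outdeg G w₁) (outdeg G u₃) _ _ _ _ (deg≥ w₁) (deg≥ u₃)
        (count-remove (arc G w₁) u₁) (count-remove (arc G u₃) v) (count-∪-∩ f g)
        (count-avoid (f ∪ g)
          ( (v≢u₁ ∷ arc⇒≢ G vu₂ ∷ arc⇒≢ G vu₃ ∷ ≢-sym w₁≢v ∷ ≢-sym w₂≢v ∷ [])
          ∷ (u₁≢u₂ ∷ u₁≢u₃ ∷ arc⇒≢ G u₁w₁ ∷ ≢-sym w₂≢u₁ ∷ [])
          ∷ (u₂≢u₃ ∷ ≢-sym w₁≢u₂ ∷ arc⇒≢ G u₂w₂ ∷ [])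
          ∷ (≢-sym (≢-arcʳ G u₁w₁ (≁-sym u₃≁u₁)) ∷ ≢-sym (≢-arcʳ G u₂w₂ (≁-sym u₃≁u₂)) ∷ [])
          ∷ (w₁≢w₂ ∷ [])
          ∷ [] ∷ [])
          ( ∨-false (remove-≁ (arc G w₁) w₁≁v)  (remove-self (arc G u₃) v)
          ∷ ∨-false (remove-self (arc G w₁) u₁) (remove-≁ (arc G u₃) u₃≁u₁)
          ∷ ∨-false (remove-≁ (arc G w₁) w₁≁u₂) (remove-≁ (arc G u₃) u₃≁u₂)
          ∷ ∨-false (remove-≁ (arc G w₁) w₁≁u₃) (remove-≁ (arc G u₃) (noLoop G u₃))
          ∷ ∨-false (remove-≁ (arc G w₁) (noLoop G w₁)) (remove-≁ (arc G u₃) (≁-sym w₁≁u₃))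
          ∷ ∨-false (remove-≁ (arc G w₁) w₁≁w₂) (remove-≁ (arc G u₃) u₃≁w₂)
          ∷ []))
        (≮⇒≥ two-common)
    where
    f g : Fin p → Bool
    f = others w₁ u₁
    g = others u₃ v
    v≢u₁ : v ≢ u₁
    v≢u₁ = arc⇒≢ G vu₁
    u₁≢u₂ : u₁ ≢ u₂
    u₁≢u₂ = arc⇒≢ G u₁u₂
    -- From here to `u₃≁w₂`, the contrary of each claim would close a 4-cycle with edges already
    -- present.
    u₃≁u₁ : u₃ ≁ u₁
    u₃≁u₁ = ≢true⇒≡false λ e → 4-cycle (≢-sym u₂≢u₃) (≢-sym v≢u₁) e u₁u₂ (symm vu₂) vu₃
    u₃≁u₂ : u₃ ≁ u₂
    u₃≁u₂ = ≢true⇒≡false λ e → 4-cycle (≢-sym u₁≢u₃) (≢-sym (arc⇒≢ G vu₂)) e (symm u₁u₂) (symm vu₁) vu₃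
    w₁≢w₂ : w₁ ≢ w₂
    w₁≢w₂ refl = 4-cycle (≢-sym w₁≢v) u₁≢u₂ vu₁ u₁w₁ (symm u₂w₂) (symm vu₂)
    w₁≁v : w₁ ≁ v
    w₁≁v = ≢true⇒≡false λ e → 4-cycle w₁≢u₂ v≢u₁ e vu₂ (symm u₁u₂) u₁w₁
    w₁≁u₂ : w₁ ≁ u₂
    w₁≁u₂ = ≢true⇒≡false λ e → 4-cycle w₁≢v (≢-sym u₁≢u₂) e (symm vu₂) vu₁ u₁w₁
    w₁≁u₃ : w₁ ≁ u₃
    w₁≁u₃ = ≢true⇒≡false λ e → 4-cycle w₁≢v (≢-sym u₁≢u₃) e (symm vu₃) vu₁ u₁w₁
    w₁≁w₂ : w₁ ≁ w₂
    w₁≁w₂ = ≢true⇒≡false λ e → 4-cycle w₁≢u₂ w₂≢u₁ e (symm u₂w₂) (symm u₁u₂) u₁w₁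
    u₃≁w₂ : u₃ ≁ w₂
    u₃≁w₂ = ≢true⇒≡false λ e → 4-cycle (≢-sym u₂≢u₃) w₂≢v e (symm u₂w₂) (symm vu₂) vu₃
    -- Two common neighbours x and y would give the 4-cycle w₁ x u₃ y.
    two-common : 1 < count (f ∩ g) → ⊥
    two-common 1< =
      let x , y , x≢y , fgx , fgy = pick₂ (f ∩ g) 1<
          fx , gx = ∧-elim {f x} fgx
          fy , gy = ∧-elim {f y} fgy
      in 4-cycle (≢-arcʳ G u₁w₁ (≁-sym u₃≁u₁)) x≢y
          (proj₁ (∖-elim (arc G w₁) fx)) (symm (proj₁ (∖-elim (arc G u₃) gx)))
          (proj₁ (∖-elim (arc G u₃) gy)) (symm (proj₁ (∖-elim (arc G w₁) fy)))

  -- Among three neighbours of v, an adjacent pair forms a triangle with v from which the third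
  -- neighbour hangs as a pendant. Excluding this for all three pairs makes the neighbours
  -- independent, which is excluded as well.
  symmetric-C4 : 7 ≤ p → (∀ x → p ≤ 2 * outdeg G x + 2) → Fin p → ⊥
  symmetric-C4 7≤p deg≥ v =
    let u₁ , u₂ , u₃ , (u₁≢u₂ , u₁≢u₃ , u₂≢u₃) , vu₁ , vu₂ , vu₃ = pick₃ (arc G v) (3≤deg v)
    in no-independent-triple (≤-trans (s≤s (s≤s (s≤s (s≤s (s≤s z≤n))))) 7≤p) deg≥
         vu₁ vu₂ vu₃ u₁≢u₂ u₁≢u₃ u₂≢u₃
         (≢true⇒≡false (no-triangle-with-pendant deg≥ 3≤deg vu₁ vu₂ vu₃ u₁≢u₃ u₂≢u₃))
         (≢true⇒≡false (no-triangle-with-pendant deg≥ 3≤deg vu₁ vu₃ vu₂ u₁≢u₂ (≢-sym u₂≢u₃)))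
         (≢true⇒≡false (no-triangle-with-pendant deg≥ 3≤deg vu₂ vu₃ vu₁ (≢-sym u₁≢u₂) (≢-sym u₁≢u₃)))
    where
    3≤deg : ∀ x → 3 ≤ outdeg G x
    3≤deg x = degree≥3 p _ 7≤p (deg≥ x)

symmetricPart : ∀ {p} → Digraph p → Digraph p
symmetricPart D = record
  { arc    = λ x y → arc D x y ∧ arc D y x
  ; noLoop = λ x → cong (_∧ arc D x x) (noLoop D x)
  }

symmetricPart-symmetric : ∀ {p} (D : Digraph p) → Symmetric (symmetricPart D)
symmetricPart-symmetric D {x} {y} h = let xy , yx = ∧-elim {arc D x y} h in ∧-intro yx xy

module _ {p : ℕ} {D : Digraph p} (dense : Dense D)
  (tight : ∀ {a b} → arc D a b ≡ true → arc D b a ≡ false → 2 * indeg D a + 2 ≤ p × 2 * outdeg D b + 2 ≤ p)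
  where

  -- If x were both the tail of one asymmetric arc and the head of another, then id(x) and od(x)
  -- would both be at most p/2 - 1, against the bound on their sum. Hence all arcs out of x or all
  -- arcs into x are symmetric, and od(x) or id(x) bounds the symmetric degree from below.
  symmetricPart-degree : ∀ x → p ≤ 2 * outdeg (symmetricPart D) x + 2
  symmetricPart-degree x
    with any? (λ y → (arc D x y Bool.≟ true) ×-dec (arc D y x Bool.≟ false))
       | any? (λ y → (arc D y x Bool.≟ true) ×-dec (arc D x y Bool.≟ false))
  ... | yes (y , xy , y↛x) | yes (z , zx , x↛z) =
        ⊥-elim (deficient p (indeg D x) (outdeg D x) (total≥ dense x) (proj₁ (tight xy y↛x)) (proj₂ (tight zx x↛z)))
  ... | no none | _       = ≤-trans (out≥ dense x) (+-monoˡ-≤ 2 (*-monoʳ-≤ 2 (count-mono _ _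
        λ y xy → ∧-intro xy (Bool.¬-not λ y↛x → none (y , xy , y↛x)))))
  ... | _       | no none = ≤-trans (in≥ dense x) (+-monoˡ-≤ 2 (*-monoʳ-≤ 2 (count-mono _ _
        λ y yx → ∧-intro (Bool.¬-not λ x↛y → none (y , yx , x↛y)) yx)))

C4-of-7≤p : ∀ {p} {D : Digraph p} → Dense D → 7 ≤ p → HasC4 D
C4-of-7≤p {p@(suc _)} {D} dense 7≤p = decidable-stable (hasC4? D) λ noC4 →
  let tight : ∀ {a b} → arc D a b ≡ true → arc D b a ≡ false → 2 * indeg D a + 2 ≤ p × 2 * outdeg D b + 2 ≤ p
      tight ab b↛a =
          ≮⇒≥ (noC4 ∘ C4-of-asymmetric dense 7≤p ab b↛a)
        -- In the converse digraph the arc runs from b to a without reverse, and od(b) becomes the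
        -- in-degree of its tail.
        , ≮⇒≥ (noC4 ∘ converse-C4 {D = D} ∘ C4-of-asymmetric (converse-dense dense) 7≤p ab b↛a)
  in SymmetricC4Free.symmetric-C4 (symmetricPart D) (λ {x} {y} → symmetricPart-symmetric D {x} {y})
       (λ (_ , _ , _ , _ , _ , a≢c , _ , _ , b≢d , _ , ab , bc , cd , da) →
          noC4 (quadrangle D a≢c b≢d (proj₁ (∧-elim ab)) (proj₁ (∧-elim bc)) (proj₁ (∧-elim cd)) (proj₁ (∧-elim da))))
       7≤p (symmetricPart-degree dense tight) fzero

-- Bipartiteness of dense digraphs without cycles of length 3

Proper : ∀ {p} → Digraph p → (Fin p → Bool) → Set
Proper D κ = ∀ x y → κ x ≡ κ y → arc D x y ≡ false

module C3Free {p : ℕ} {D : Digraph p} (dense : Dense D) (6≤p : 6 ≤ p) (noC3 : ¬ HasC3 D) where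

  private
    _⟶_ _↛_ : Fin p → Fin p → Set
    x ⟶ y = arc D x y ≡ true
    x ↛ y = arc D x y ≡ false

    _⟶?_ : ∀ x y → Dec (x ⟶ y)
    x ⟶? y = arc D x y Bool.≟ true

    _↛?_ : ∀ x y → Dec (x ↛ y)
    x ↛? y = arc D x y Bool.≟ false

    O I : Fin p → Fin p → Bool
    O x y = arc D x y
    I x y = arc D y x

    3-cycle : ∀ {a b c} → a ⟶ b → b ⟶ c → c ⟶ a → ⊥
    3-cycle ab bc ca = noC3 (triangle D ab bc ca)

  -- A vertex in both O(t) and I(u) would close a triangle with u → t. Both sets also miss u and t,
  -- as t → u is absent.
  asymmetric-degrees : ∀ {u t} → u ⟶ t → t ↛ u → outdeg D t + indeg D u + 2 ≤ p
  asymmetric-degrees {u} {t} ut t↛u = count-avoid₂ (O t) (I u)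
    (λ x tx xu → 3-cycle ut tx xu) ((arc⇒≢ D ut ∷ []) ∷ [] ∷ [])
    ((t↛u , noLoop D u) ∷ (noLoop D t , t↛u) ∷ [])

  -- The two degrees add up to at most p - 2 and each is at least p/2 - 1, so neither has any slack.
  asymmetric-tight : ∀ {u t} → u ⟶ t → t ↛ u → 2 * indeg D u + 2 ≤ p × 2 * outdeg D t + 2 ≤ p
  asymmetric-tight {u} {t} ut t↛u =
      ≮⇒≥ (λ p< → both-large p (outdeg D t) (indeg D u) p< (out≥ dense t) bound)
    , ≮⇒≥ (λ p< → both-large p (indeg D u) (outdeg D t) p< (in≥ dense u)
        (subst (λ k → k + 2 ≤ p) (+-comm (outdeg D t) (indeg D u)) bound))
    where
    bound = asymmetric-degrees ut t↛u

  -- O(t) and I(u) are disjoint with at least p - 2 vertices in all. They already miss u and t,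
  -- hence no third vertex.
  asymmetric-cover : ∀ {u t} → u ⟶ t → t ↛ u → ∀ {x} → x ≢ u → x ≢ t → t ↛ x → x ⟶ u
  asymmetric-cover {u} {t} ut t↛u {x} x≢u x≢t t↛x = Bool.¬-not λ x↛u →
    uncovered p (indeg D u) (outdeg D t) (in≥ dense u) (out≥ dense t) (count-avoid₂ (O t) (I u)
      (λ y ty yu → 3-cycle ut ty yu)
      ((arc⇒≢ D ut ∷ ≢-sym x≢u ∷ []) ∷ (≢-sym x≢t ∷ []) ∷ [] ∷ [])
      ((t↛u , noLoop D u) ∷ (noLoop D t , t↛u) ∷ (t↛x , x↛u) ∷ []))

  module Asymmetric {u t : Fin p} (ut : u ⟶ t) (t↛u : t ↛ u) where

    exclusive : ∀ {x} → t ⟶ x → x ↛ u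
    exclusive tx = ≢true⇒≡false (3-cycle ut tx)

    -- The arc u → t limits od(t) to p/2 - 1. An asymmetric arc t → y would limit id(t) likewise,
    -- making the total degree of t too small.
    out-t-symmetric : ∀ {y} → t ⟶ y → y ⟶ t
    out-t-symmetric {y} ty = Bool.¬-not λ y↛t → deficient p (indeg D t) (outdeg D t) (total≥ dense t)
      (proj₁ (asymmetric-tight ty y↛t)) (proj₂ (asymmetric-tight ut t↛u))

    in-u-symmetric : ∀ {y} → y ⟶ u → u ⟶ y
    in-u-symmetric {y} yu = Bool.¬-not λ u↛y → deficient p (indeg D u) (outdeg D u) (total≥ dense u)
      (proj₁ (asymmetric-tight ut t↛u)) (proj₂ (asymmetric-tight yu u↛y))

    out-t-independent : ∀ {x y} → t ⟶ x → t ⟶ y → x ↛ y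
    out-t-independent tx ty = ≢true⇒≡false λ xy → 3-cycle tx xy (out-t-symmetric ty)

    in-u-independent : ∀ {x y} → x ⟶ u → y ⟶ u → x ↛ y
    in-u-independent xu yu = ≢true⇒≡false λ xy → 3-cycle (in-u-symmetric xu) xy yu

    -- An arc from u to y ∈ O(t) would be asymmetric too, so O(y) would contain the rest of O(t).
    u↛out-t : ∀ {y} → t ⟶ y → u ↛ y
    u↛out-t {y} ty = ≢true⇒≡false λ uy →
      let x , tx , x≢y∷ = pick (O t) (y ∷ []) (degree≥2 p (outdeg D t) 6≤p (out≥ dense t))
      in true≢false
        (asymmetric-cover′ uy (exclusive ty) (≢-arcʳ D tx t↛u) (All.head x≢y∷) (exclusive tx))
        (out-t-independent ty tx)
      where
      asymmetric-cover′ : ∀ {u t} → u ⟶ t → t ↛ u → ∀ {x} → x ≢ u → x ≢ t → x ↛ u → t ⟶ x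
      asymmetric-cover′ ut t↛u x≢u x≢t x↛u =
        Bool.¬-not λ t↛x → true≢false (asymmetric-cover ut t↛u x≢u x≢t t↛x) x↛u

    -- Dual to `u↛out-t`: an arc s → t would be asymmetric, so any other x in I(u) would have to lie
    -- in I(s), although I(u) is independent.
    in-u↛t : ∀ {s} → s ⟶ u → s ↛ t
    in-u↛t {s} su = ≢true⇒≡false λ st →
      let x , xu , x≢s∷ = pick (I u) (s ∷ []) (degree≥2 p (indeg D u) 6≤p (in≥ dense u))
      in true≢false
        (asymmetric-cover st (t↛in-u su) (All.head x≢s∷) (≢-arcˡ D xu t↛u) (t↛in-u xu))
        (in-u-independent xu su)
      where
      t↛in-u : ∀ {s} → s ⟶ u → t ↛ s
      t↛in-u su = ≢true⇒≡false λ ts → 3-cycle ut ts su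

    colour : Fin p → Bool
    colour x = ⁅ u ⁆ x ∨ arc D t x

    colour-true : ∀ x → colour x ≡ true → x ≡ u ⊎ t ⟶ x
    colour-true x h with x ≟ u
    ... | yes x≡u = inj₁ x≡u
    ... | no  _   = inj₂ h

    colour-false : ∀ x → colour x ≡ false → t ↛ x × (x ≡ t ⊎ x ⟶ u)
    colour-false x h with x ≟ u | x ≟ t
    ... | no x≢u | yes x≡t = h , inj₁ x≡t
    ... | no x≢u | no x≢t  = h , inj₂ (asymmetric-cover ut t↛u x≢u x≢t h)

    proper-true : ∀ x y → x ≡ u ⊎ t ⟶ x → y ≡ u ⊎ t ⟶ y → x ↛ y
    proper-true x y (inj₁ refl) (inj₁ refl) = noLoop D u
    proper-true x y (inj₁ refl) (inj₂ ty)   = u↛out-t ty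
    proper-true x y (inj₂ tx)   (inj₁ refl) = exclusive tx
    proper-true x y (inj₂ tx)   (inj₂ ty)   = out-t-independent tx ty

    proper-false : ∀ x y → t ↛ x × (x ≡ t ⊎ x ⟶ u) → t ↛ y × (y ≡ t ⊎ y ⟶ u) → x ↛ y
    proper-false x y (_ , inj₁ refl) (t↛y , _)       = t↛y
    proper-false x y (_ , inj₂ xu)   (_ , inj₁ refl) = in-u↛t xu
    proper-false x y (_ , inj₂ xu)   (_ , inj₂ yu)   = in-u-independent xu yu

    proper : Proper D colour
    proper x y eq with colour x in ex | colour y in ey
    ... | true  | true  = proper-true x y (colour-true x ex) (colour-true y ey)
    ... | false | false = proper-false x y (colour-false x ex) (colour-false y ey)

  module AllSymmetric (symm : Symmetric D) where

    -- By symmetry id(x) ≤ od(x), so the total degree yields (p - 1)/2, which is better than p/2 - 1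
    -- by one half. Two disjoint neighbourhoods therefore leave out at most one vertex.
    degree≥ : ∀ x → p ≤ suc (outdeg D x + outdeg D x)
    degree≥ x = ≤-trans (total≥ dense x)
      (s≤s (+-monoˡ-≤ (outdeg D x) (count-mono (I x) (O x) λ y → symm)))

    disjoint-nbrs : ∀ {u v} → u ⟶ v → Disjoint (O u) (O v)
    disjoint-nbrs uv x ux vx = 3-cycle uv vx (symm ux)

    ↛-sym : ∀ {x y} → x ↛ y → y ↛ x
    ↛-sym x↛y = ≢true⇒≡false λ yx → true≢false (symm yx) x↛y

    module Uncovered {u v w : Fin p} (uv : u ⟶ v) (u↛w : u ↛ w) (v↛w : v ↛ w) where

      -- Otherwise N(w) and N(v) would be disjoint and leave out both v and w.
      shares-neighbour : ∃[ b ] w ⟶ b × v ⟶ b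
      shares-neighbour with any? (λ b → (w ⟶? b) ×-dec (v ⟶? b))
      ... | yes b = b
      ... | no none = ⊥-elim (two-uncovered p (outdeg D w) (outdeg D v) (degree≥ w) (degree≥ v)
              (count-avoid₂ (O w) (O v) (λ x wx vx → none (x , wx , vx))
                ((≢-arcʳ D uv u↛w ∷ []) ∷ [] ∷ [])
                ((↛-sym v↛w , noLoop D v) ∷ (noLoop D w , v↛w) ∷ [])))

      -- N(a), N(u) and N(w) ∩ N(v) are pairwise disjoint, since a common vertex would complete a
      -- triangle on the edge au, wa or uv. The first two leave out at most one vertex.
      shared≤1 : ∀ {a} → w ⟶ a → u ⟶ a → count (O w ∩ O v) ≤ 1
      shared≤1 {a} wa ua = remainder≤1 p (outdeg D a) (outdeg D u) _ (degree≥ a) (degree≥ u)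
        (count-avoid₃ (O a) (O u) (O w ∩ O v)
          (disjoint-nbrs (symm ua))
          (λ x ax wvx → 3-cycle wa ax (symm (proj₁ (∧-elim wvx))))
          (λ x ux wvx → disjoint-nbrs uv x ux (proj₂ (∧-elim {O w x} wvx))) [] [])

    -- Being the only uncovered vertex, w has all its neighbours in N(u) ∪ N(v), at most one in each.
    covered : ∀ {u v} → u ⟶ v → ∀ w → u ↛ w → v ↛ w → ⊥
    covered {u} {v} uv w u↛w v↛w =
      let a , wa , ua = Uncovered.shares-neighbour (symm uv) v↛w u↛w
          b , wb , vb = Uncovered.shares-neighbour uv u↛w v↛w
          few-v = Uncovered.shared≤1 uv u↛w v↛w wa ua
          few-u = Uncovered.shared≤1 (symm uv) v↛w u↛w wb vb
      in <-irrefl refl (≤-trans (half≥3 p (outdeg D w) 6≤p (degree≥ w))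
        (≤-trans (≤-reflexive (count-split (O w) (O u)))
          (few-u ⊕ ≤-trans (count-mono (O w ∖ O u) (O w ∩ O v) rest) few-v)))
      where
      rest : ∀ x → (O w ∖ O u) x ≡ true → (O w ∩ O v) x ≡ true
      rest x h with arc D v x in v↛x
      ... | true  = ∧-intro (proj₁ (∧-elim h)) refl
      -- A neighbour x of w outside N(u) and N(v) would be a second vertex that these disjoint sets
      -- leave out.
      ... | false = ⊥-elim (two-uncovered p (outdeg D u) (outdeg D v) (degree≥ u) (degree≥ v)
              (count-avoid₂ (O u) (O v) (disjoint-nbrs uv) ((arc⇒≢ D (proj₁ (∧-elim h)) ∷ []) ∷ [] ∷ [])
                ((u↛w , v↛w) ∷ (not-true (proj₂ (∧-elim {O w x} h)) , v↛x) ∷ [])))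

    proper : ∀ {u v} → u ⟶ v → Proper D (O v)
    proper {u} {v} uv x y eq with arc D v x in vx | arc D v y in vy
    ... | true  | true  = ≢true⇒≡false λ xy → 3-cycle vx xy (symm vy)
    ... | false | false = ≢true⇒≡false λ xy → 3-cycle (nbr-u x vx) xy (symm (nbr-u y vy))
      where
      nbr-u : ∀ x → v ↛ x → u ⟶ x
      nbr-u x v↛x = Bool.¬-not λ u↛x → covered uv x u↛x v↛x

  proper-colouring : Fin p → ∃[ κ ] Proper D κ
  proper-colouring x with any? (λ u → any? λ t → (u ⟶? t) ×-dec (t ↛? u))
  ... | yes (u , t , ut , t↛u) = _ , Asymmetric.proper ut t↛u
  ... | no none =
    let v , xv , _ = pick (O x) [] (≤-trans (s≤s z≤n) (degree≥2 p (outdeg D x) 6≤p (out≥ dense x)))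
    in _ , AllSymmetric.proper (λ {a} {b} ab → Bool.¬-not λ b↛a → none (a , b , ab , b↛a)) xv

open _≅_

-- Recognising K*(n,n+1) and the members of B(n,n)

-- Adding the complement of `g` turns a bound relative to `g` into one relative to all of `Fin n`.
count-within : ∀ {n} (f g : Fin n → Bool) {ys : List (Fin n)} → (∀ x → f x ≡ true → g x ≡ true) →
  Unique ys → All (λ y → f y ≡ false × g y ≡ true) ys → count f + length ys ≤ count g
count-within {n} f g {ys} f⊆g u a = +-cancelʳ-≤ (count (not ∘ g)) _ _ (begin
  count f + length ys + count (not ∘ g)   ≡⟨ +-assoc (count f) (length ys) _ ⟩
  count f + (length ys + count (not ∘ g)) ≡⟨ cong (count f +_) (+-comm (length ys) _) ⟩
  count f + (count (not ∘ g) + length ys) ≡⟨ +-assoc (count f) _ _ ⟨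
  count f + count (not ∘ g) + length ys   ≤⟨ count-avoid₂ f (not ∘ g)
                                               (λ x fx ngx → true≢false (f⊆g x fx) (not-true ngx)) u
                                               (All.map (λ (fy , gy) → fy , cong not gy) a) ⟩
  n                                       ≡⟨ count-complement g ⟨
  count g + count (not ∘ g)               ∎)
  where open ≤-Reasoning

Classes : ∀ {n} → (Fin n → Bool) → Set
Classes f = Fin (count f) ⊎ Fin (count (not ∘ f))

-- The position of x among the vertices of its own class, in increasing order. With its inverse
-- `unrank` it numbers the two classes separately.
rank : ∀ {n} (f : Fin n → Bool) → Fin n → Classes f
rank {suc n} f x with f fzero
rank {suc n} f fzero    | true  = inj₁ fzero
rank {suc n} f fzero    | false = inj₂ fzero
rank {suc n} f (fsuc x) | true  = Sum.map₁ fsuc (rank (f ∘ fsuc) x)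
rank {suc n} f (fsuc x) | false = Sum.map₂ fsuc (rank (f ∘ fsuc) x)

unrank : ∀ {n} (f : Fin n → Bool) → Classes f → Fin n
unrank {zero}  f (inj₁ ())
unrank {zero}  f (inj₂ ())
unrank {suc n} f c with f fzero
unrank {suc n} f (inj₁ fzero)    | true  = fzero
unrank {suc n} f (inj₁ (fsuc i)) | true  = fsuc (unrank (f ∘ fsuc) (inj₁ i))
unrank {suc n} f (inj₂ j)        | true  = fsuc (unrank (f ∘ fsuc) (inj₂ j))
unrank {suc n} f (inj₁ i)        | false = fsuc (unrank (f ∘ fsuc) (inj₁ i))
unrank {suc n} f (inj₂ fzero)    | false = fzero
unrank {suc n} f (inj₂ (fsuc j)) | false = fsuc (unrank (f ∘ fsuc) (inj₂ j))

unrank-rank : ∀ {n} (f : Fin n → Bool) x → unrank f (rank f x) ≡ x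
unrank-rank {suc n} f x with f fzero
unrank-rank {suc n} f fzero    | true  = refl
unrank-rank {suc n} f fzero    | false = refl
unrank-rank {suc n} f (fsuc x) | true with rank (f ∘ fsuc) x | unrank-rank (f ∘ fsuc) x
... | inj₁ _ | eq = cong fsuc eq
... | inj₂ _ | eq = cong fsuc eq
unrank-rank {suc n} f (fsuc x) | false with rank (f ∘ fsuc) x | unrank-rank (f ∘ fsuc) x
... | inj₁ _ | eq = cong fsuc eq
... | inj₂ _ | eq = cong fsuc eq

rank-unrank : ∀ {n} (f : Fin n → Bool) c → rank f (unrank f c) ≡ c
rank-unrank {zero}  f (inj₁ ())
rank-unrank {zero}  f (inj₂ ())
rank-unrank {suc n} f c with f fzero
rank-unrank {suc n} f (inj₁ fzero)    | true  = refl
rank-unrank {suc n} f (inj₁ (fsuc i)) | true  = cong (Sum.map₁ fsuc) (rank-unrank (f ∘ fsuc) (inj₁ i))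
rank-unrank {suc n} f (inj₂ j)        | true  = cong (Sum.map₁ fsuc) (rank-unrank (f ∘ fsuc) (inj₂ j))
rank-unrank {suc n} f (inj₁ i)        | false = cong (Sum.map₂ fsuc) (rank-unrank (f ∘ fsuc) (inj₁ i))
rank-unrank {suc n} f (inj₂ fzero)    | false = refl
rank-unrank {suc n} f (inj₂ (fsuc j)) | false = cong (Sum.map₂ fsuc) (rank-unrank (f ∘ fsuc) (inj₂ j))

isInj₁ : ∀ {A B : Set} → A ⊎ B → Bool
isInj₁ (inj₁ _) = true
isInj₁ (inj₂ _) = false

rank-class : ∀ {n} (f : Fin n → Bool) x → isInj₁ (rank f x) ≡ f x
rank-class {suc n} f x with f fzero in eq
rank-class {suc n} f fzero    | true  = sym eq
rank-class {suc n} f fzero    | false = sym eq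
rank-class {suc n} f (fsuc x) | true with rank (f ∘ fsuc) x | rank-class (f ∘ fsuc) x
... | inj₁ _ | h = h
... | inj₂ _ | h = h
rank-class {suc n} f (fsuc x) | false with rank (f ∘ fsuc) x | rank-class (f ∘ fsuc) x
... | inj₁ _ | h = h
... | inj₂ _ | h = h

join-class : ∀ a b (c : Fin a ⊎ Fin b) → (toℕ (join a b c) <ᵇ a) ≡ isInj₁ c
join-class a b (inj₁ i) rewrite toℕ-↑ˡ i b = Bool.T-≡ .Equivalence.to (<⇒<ᵇ (toℕ<n i))
join-class a b (inj₂ j) rewrite toℕ-↑ʳ a j = ≢true⇒≡false λ h →
  <⇒≱ (<ᵇ⇒< (a + toℕ j) a (Bool.T-≡ .Equivalence.from h)) (m≤m+n a (toℕ j))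

-- The vertex map of an isomorphism onto `Kstar a b` or a subdigraph of it: `Kstar` tells its sides
-- apart by the test `<ᵇ a`, and `side` matches this test with the colour.
record Layout {p : ℕ} (κ : Fin p → Bool) (a b : ℕ) : Set where
  field
    place     : Fin p → Fin (a + b)
    at        : Fin (a + b) → Fin p
    at-place  : ∀ x → at (place x) ≡ x
    place-at  : ∀ i → place (at i) ≡ i
    side      : ∀ x → (toℕ (place x) <ᵇ a) ≡ κ x
open Layout

layout : ∀ {p} (κ : Fin p → Bool) {a b} → count κ ≡ a → count (not ∘ κ) ≡ b → Layout κ a b
layout κ {a} {b} refl refl = record
  { place    = join a b ∘ rank κ
  ; at       = unrank κ ∘ splitAt a
  ; at-place = λ x → trans (cong (unrank κ) (splitAt-join a b (rank κ x))) (unrank-rank κ x)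
  ; place-at = λ i → trans (cong (join a b) (rank-unrank κ (splitAt a i))) (join-splitAt a b i)
  ; side     = λ x → trans (join-class a b (rank κ x)) (rank-class κ x)
  }

Kstar-arc : ∀ a b x y → arc (Kstar a b) x y ≡ (toℕ x <ᵇ a) xor (toℕ y <ᵇ a)
Kstar-arc a b x y with x ≟ y
... | yes refl = sym (Bool.xor-same (toℕ x <ᵇ a))
... | no  _    = refl

Kstar-layout : ∀ {p a b} {κ : Fin p → Bool} (l : Layout κ a b) x y →
  arc (Kstar a b) (place l x) (place l y) ≡ κ x xor κ y
Kstar-layout {a = a} {b} l x y = trans (Kstar-arc a b _ _) (cong₂ _xor_ (side l x) (side l y))

half-even : ∀ a → (a + a) / 2 ≡ a
half-even a = trans (cong (_/ 2) (trans (cong (a +_) (sym (+-identityʳ a))) (*-comm 2 a))) (m*n/n≡m a 2)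

half-odd : ∀ a → (a + suc a) / 2 ≡ a
half-odd a = trans (cong (_/ 2) (trans (+-suc a a) (sym (+-comm (a + a) 1))))
  (trans (+-distrib-/-∣ˡ 1 (divides a (trans (cong (a +_) (sym (+-identityʳ a))) (*-comm 2 a))))
    (trans (+-identityʳ _) (half-even a)))

-- Dense digraphs with a proper 2-colouring.

module Coloured {p : ℕ} {D : Digraph p} (dense : Dense D) {κ : Fin p → Bool} (proper : Proper D κ) where

  opposite : Fin p → Fin p → Bool
  opposite x y = κ x xor κ y

  out⊆opposite : ∀ x y → arc D x y ≡ true → opposite x y ≡ true
  out⊆opposite x y xy with κ x in ex | κ y in ey
  ... | true  | false = refl
  ... | false | true  = refl
  ... | true  | true  = ⊥-elim (true≢false xy (proper x y (trans ex (sym ey))))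
  ... | false | false = ⊥-elim (true≢false xy (proper x y (trans ex (sym ey))))

  in⊆opposite : ∀ x y → arc D y x ≡ true → opposite x y ≡ true
  in⊆opposite x y yx = trans (Bool.xor-comm (κ x) (κ y)) (out⊆opposite y x yx)

  opposite-true : ∀ {x} → κ x ≡ true → count (opposite x) ≡ count (not ∘ κ)
  opposite-true {x} κx = count-cong (opposite x) (not ∘ κ) λ y → cong (_xor κ y) κx

  opposite-false : ∀ {x} → κ x ≡ false → count (opposite x) ≡ count κ
  opposite-false {x} κx = count-cong (opposite x) κ λ y → cong (_xor κ y) κx

  -- O(x) and I(x) both lie in the class opposite to x, so p - 1 is at most twice the size of that
  -- class.
  opposite-size : ∀ x → p ≤ suc (count (opposite x) + count (opposite x))
  opposite-size x = class-size p (indeg D x) (outdeg D x) _ (total≥ dense x)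
    (count-mono _ _ (in⊆opposite x)) (count-mono _ _ (out⊆opposite x))

  -- An arc out of x has its ends in different classes, so each class is opposite to some vertex.
  class-sizes : 3 ≤ p → (x : Fin p) →
    p ≤ suc (count κ + count κ) × p ≤ suc (count (not ∘ κ) + count (not ∘ κ))
  class-sizes 3≤p x with pick (arc D x) [] (positive p (outdeg D x) 3≤p (out≥ dense x))
  ... | y , xy , _ with κ x in ex | κ y in ey | out⊆opposite x y xy
  ...   | true  | false | _ = subst (λ k → p ≤ suc (k + k)) (opposite-false ey) (opposite-size y)
                            , subst (λ k → p ≤ suc (k + k)) (opposite-true ex) (opposite-size x)
  ...   | false | true  | _ = subst (λ k → p ≤ suc (k + k)) (opposite-false ex) (opposite-size x)
                            , subst (λ k → p ≤ suc (k + k)) (opposite-true ey) (opposite-size y)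

  module Unbalanced {a : ℕ} (κ≡ : count κ ≡ a) (¬κ≡ : count (not ∘ κ) ≡ suc a) where

    p≡ : p ≡ a + suc a
    p≡ = trans (sym (count-complement κ)) (cong₂ _+_ κ≡ ¬κ≡)

    -- A vertex x of the larger class has od(x), id(x) ≥ a, the size of the smaller class.
    complete-from-false : ∀ {x y} → κ x ≡ false → κ y ≡ true → arc D x y ≡ true × arc D y x ≡ true
    complete-from-false {x} {y} κx κy =
        Bool.¬-not (λ x↛y → one-missing p (outdeg D x) a p≡ (out≥ dense x)
          (subst (outdeg D x + 1 ≤_) size (count-within (arc D x) (opposite x) (out⊆opposite x) ([] ∷ []) ((x↛y , opp) ∷ []))))
      , Bool.¬-not (λ y↛x → one-missing p (indeg D x) a p≡ (in≥ dense x)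
          (subst (indeg D x + 1 ≤_) size (count-within (λ z → arc D z x) (opposite x) (in⊆opposite x) ([] ∷ []) ((y↛x , opp) ∷ []))))
      where
      size : count (opposite x) ≡ a
      size = trans (opposite-false κx) κ≡
      opp : opposite x y ≡ true
      opp = cong₂ _xor_ κx κy

    arc≡opposite : ∀ x y → arc D x y ≡ opposite x y
    arc≡opposite x y with κ x in ex | κ y in ey
    ... | true  | true  = proper x y (trans ex (sym ey))
    ... | false | false = proper x y (trans ex (sym ey))
    ... | true  | false = proj₂ (complete-from-false ey ex)
    ... | false | true  = proj₁ (complete-from-false ex ey)

    ≅Kstar : D ≅ Kstar (p / 2) (suc (p / 2))
    ≅Kstar = subst (λ n → D ≅ Kstar n (suc n)) (sym (trans (cong (_/ 2) p≡) (half-odd a))) (record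
      { to       = place l
      ; from     = at l
      ; from∘to  = at-place l
      ; to∘from  = place-at l
      ; preserve = λ x y → trans (arc≡opposite x y) (sym (Kstar-layout l x y))
      })
      where
      l : Layout κ a (suc a)
      l = layout κ κ≡ ¬κ≡

  module Balanced {a : ℕ} (κ≡ : count κ ≡ a) (¬κ≡ : count (not ∘ κ) ≡ a) where

    p≡ : p ≡ a + a
    p≡ = trans (sym (count-complement κ)) (cong₂ _+_ κ≡ ¬κ≡)

    size : ∀ x → count (opposite x) ≡ a
    size x with κ x Bool.≟ true
    ... | yes κx = trans (opposite-true κx) ¬κ≡
    ... | no ¬κx = trans (opposite-false (≢true⇒≡false ¬κx)) κ≡

    Missing : Fin p → Fin p → Set
    Missing x y = opposite x y ≡ true × arc D x y ≡ false

    within-out : ∀ {x ys} → Unique ys → All (Missing x) ys → outdeg D x + length ys ≤ a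
    within-out {x} u m = subst (_ ≤_) (size x)
      (count-within (arc D x) (opposite x) (out⊆opposite x) u (All.map (λ (o , n) → n , o) m))

    within-in : ∀ {x ys} → Unique ys → All (λ y → Missing y x) ys → indeg D x + length ys ≤ a
    within-in {x} u m = subst (_ ≤_) (size x)
      (count-within (λ z → arc D z x) (opposite x) (in⊆opposite x) u
        (All.map (λ {y} (o , n) → n , trans (Bool.xor-comm (κ x) (κ y)) o) m))

    -- With p = 2a every out-degree is at least a - 1, while the opposite class has a vertices.
    missing-out-unique : ∀ {x y v} → Missing x y → Missing x v → y ≡ v
    missing-out-unique {x} {y} {v} xy xv = decidable-stable (y ≟ v) λ y≢v →
      two-missing p (outdeg D x) a p≡ (out≥ dense x) (within-out ((y≢v ∷ []) ∷ [] ∷ []) (xy ∷ xv ∷ []))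

    missing-in-unique : ∀ {x u y} → Missing x y → Missing u y → x ≡ u
    missing-in-unique {x} {u} {y} xy uy = decidable-stable (x ≟ u) λ x≢u →
      two-missing p (indeg D y) a p≡ (in≥ dense y) (within-in ((x≢u ∷ []) ∷ [] ∷ []) (xy ∷ uy ∷ []))

    -- The total degree of y is at least 2a - 1, so one missing arc in and one out is too much. With
    -- the two uniqueness lemmas this makes the missing arcs vertex-disjoint.
    missing-not-consecutive : ∀ {x y z} → Missing x y → Missing y z → ⊥
    missing-not-consecutive {y = y} xy yz = both-missing p (indeg D y) (outdeg D y) a p≡ (total≥ dense y)
      (within-in ([] ∷ []) (xy ∷ [])) (within-out ([] ∷ []) (yz ∷ []))

    private
      l : Layout κ a a
      l = layout κ κ≡ ¬κ≡

    deleted : Fin (a + a) → Fin (a + a) → Bool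
    deleted i j = arc (Kstar a a) i j ∧ not (arc D (at l i) (at l j))

    deleted⇒missing : ∀ {i j} → deleted i j ≡ true → Missing (at l i) (at l j)
    deleted⇒missing {i} {j} h =
        trans (sym (Kstar-layout l _ _)) (trans (cong₂ (arc (Kstar a a)) (place-at l i) (place-at l j)) (proj₁ (∧-elim h)))
      , not-true (proj₂ (∧-elim {arc (Kstar a a) i j} h))

    at-injective : ∀ {i j} → at l i ≡ at l j → i ≡ j
    at-injective {i} {j} eq = trans (sym (place-at l i)) (trans (cong (place l) eq) (place-at l j))

    deleted-disjoint : DisjointArcsOf (Kstar a a) deleted
    deleted-disjoint = (λ i j → proj₁ ∘ ∧-elim) , λ i j k m ij km → disjoint i j k m (deleted⇒missing ij) (deleted⇒missing km)
      where
      disjoint : ∀ i j k m → Missing (at l i) (at l j) → Missing (at l k) (at l m) →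
        (i ≡ k × j ≡ m) ⊎ (i ≢ k × i ≢ m × j ≢ k × j ≢ m)
      disjoint i j k m ij km with i ≟ k | j ≟ m
      ... | yes refl | _        = inj₁ (refl , at-injective (missing-out-unique ij km))
      ... | no i≢k   | yes refl = ⊥-elim (i≢k (at-injective (missing-in-unique ij km)))
      ... | no i≢k   | no j≢m   = inj₂
        (i≢k , (λ { refl → missing-not-consecutive km ij }) , (λ { refl → missing-not-consecutive ij km }) , j≢m)

    ≅deleted : D ≅ deleteArcs (Kstar a a) deleted
    ≅deleted = record
      { to       = place l
      ; from     = at l
      ; from∘to  = at-place l
      ; to∘from  = place-at l
      ; preserve = λ x y → trans (restore (out⊆opposite x y))
          (sym (cong₂ (λ k d → k ∧ not (k ∧ not d)) (Kstar-layout l x y) (cong₂ (arc D) (at-place l x) (at-place l y))))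
      }
      where
      restore : ∀ {d k} → (d ≡ true → k ≡ true) → d ≡ k ∧ not (k ∧ not d)
      restore {false} {false} _ = refl
      restore {false} {true}  _ = refl
      restore {true}  {k} d⇒k rewrite d⇒k refl = refl

    InB-half : 6 ≤ p → InB (p / 2) D
    InB-half 6≤p = subst (λ n → InB n D) (sym (trans (cong (_/ 2) p≡) (half-even a)))
      (half≥3 p a 6≤p (m≤n⇒m≤1+n (≤-reflexive p≡)) , deleted , deleted-disjoint , ≅deleted)

  -- A colour class is independent and has at least three vertices, so it can be the avoided set for
  -- two of its own members.
  C4-of-6≤p : 6 ≤ p → HasC4 D
  C4-of-6≤p 6≤p@(s≤s _) =
    let 3≤κ = half≥3 p (count κ) 6≤p (proj₁ (class-sizes (≤-trans (s≤s (s≤s (s≤s z≤n))) 6≤p) fzero))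
        s , t , s≢t , κs , κt = pick₂ κ (≤-trans (s≤s (s≤s z≤n)) 3≤κ)
        avoids = λ {s} (κs : κ s ≡ true) x κx →
          proper s x (trans κs (sym κx)) , proper x s (trans κx (sym κs))
    in quadrangle-through dense κ s≢t (avoids κs) (avoids κt) 3≤κ

Proper-not : ∀ {p} {D : Digraph p} {κ} → Proper D κ → Proper D (not ∘ κ)
Proper-not proper x y eq = proper x y (Bool.not-injective eq)

bipartite-classification : ∀ {p} {D : Digraph p} → Dense D → 6 ≤ p → ∀ {κ} → Proper D κ →
  InB (p / 2) D ⊎ D ≅ Kstar (p / 2) (suc (p / 2))
bipartite-classification {p@(suc _)} {D} dense 6≤p {κ} proper =
  let h , k = Coloured.class-sizes dense proper (≤-trans (s≤s (s≤s (s≤s z≤n))) 6≤p) fzero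
  in case (balance p (count κ) (count (not ∘ κ)) (count-complement κ) h k)
  where
  case : count κ ≡ count (not ∘ κ) ⊎ count (not ∘ κ) ≡ suc (count κ) ⊎ count κ ≡ suc (count (not ∘ κ)) →
    InB (p / 2) D ⊎ D ≅ Kstar (p / 2) (suc (p / 2))
  case (inj₁ eq) = inj₁ (Coloured.Balanced.InB-half dense proper eq refl 6≤p)
  case (inj₂ (inj₁ eq)) = inj₂ (Coloured.Unbalanced.≅Kstar dense proper refl eq)
  -- The smaller class must come first, so the colours are exchanged.
  case (inj₂ (inj₂ eq)) = inj₂ (Coloured.Unbalanced.≅Kstar dense (Proper-not {D = D} {κ} proper) refl
    (trans (count-cong (not ∘ not ∘ κ) κ (Bool.not-involutive ∘ κ)) eq))

-- Exhaustive search for p = 5 and p = 6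

≅-trans : ∀ {p q r} {D : Digraph p} {E : Digraph q} {F : Digraph r} → D ≅ E → E ≅ F → D ≅ F
≅-trans f g = record
  { to       = to g ∘ to f
  ; from     = from f ∘ from g
  ; from∘to  = λ x → trans (cong (from f) (from∘to g (to f x))) (from∘to f x)
  ; to∘from  = λ y → trans (cong (to g) (to∘from f (from g y))) (to∘from g y)
  ; preserve = λ x y → trans (preserve f x y) (preserve g (to f x) (to f y))
  }

≅-sym : ∀ {p q} {D : Digraph p} {E : Digraph q} → D ≅ E → E ≅ D
≅-sym {E = E} f = record
  { to       = from f
  ; from     = to f
  ; from∘to  = to∘from f
  ; to∘from  = from∘to f
  ; preserve = λ x y → sym (trans (preserve f _ _) (cong₂ (arc E) (to∘from f x) (to∘from f y)))
  }

count-sum : ∀ {n} (f : Fin n → Bool) → count f ≡ sum (λ x → if f x then 1 else 0)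
count-sum {zero}  f = refl
count-sum {suc n} f = cong ((if f fzero then 1 else 0) +_) (count-sum (f ∘ fsuc))

-- Keeps degrees and class sizes unchanged under relabelling: written as a sum, a count does not
-- depend on the order of the vertices.
count-permute : ∀ {n} (f : Fin n → Bool) (π : Permutation′ n) → count f ≡ count (f ∘ (π ⟨$⟩ʳ_))
count-permute f π = trans (count-sum f)
  (trans (sum-permute (λ x → if f x then 1 else 0) π) (sym (count-sum (f ∘ (π ⟨$⟩ʳ_)))))

count-≅ : ∀ {p} {D E : Digraph p} (φ : D ≅ E) (f : Fin p → Bool) → count f ≡ count (f ∘ to φ)
count-≅ φ f = count-permute f (permutation (to φ) (from φ) (to∘from φ) (from∘to φ))

module Transport {p : ℕ} {D E : Digraph p} (φ : D ≅ E) where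

  arc-from : ∀ {x y} → arc E x y ≡ true → arc D (from φ x) (from φ y) ≡ true
  arc-from xy = trans (sym (preserve (≅-sym φ) _ _)) xy

  from-injective : ∀ {x y} → x ≢ y → from φ x ≢ from φ y
  from-injective x≢y eq = x≢y (trans (sym (to∘from φ _)) (trans (cong (to φ) eq) (to∘from φ _)))

  C3 : HasC3 E → HasC3 D
  C3 (_ , _ , _ , _ , _ , _ , ab , bc , ca) = triangle D (arc-from ab) (arc-from bc) (arc-from ca)

  C4 : HasC4 E → HasC4 D
  C4 (_ , _ , _ , _ , _ , a≢c , _ , _ , b≢d , _ , ab , bc , cd , da) =
    quadrangle D (from-injective a≢c) (from-injective b≢d) (arc-from ab) (arc-from bc) (arc-from cd) (arc-from da)

  H : ∀ {n} → InH n E → InH n D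
  H (inF , F≡ , B≡ , complete , no-back , F-out , B-in) =
      inF ∘ to φ
    , trans (sym (count-≅ φ inF)) F≡
    , trans (sym (count-≅ φ (not ∘ inF))) B≡
    , (λ x y x≢y eq → trans (preserve φ x y) (complete _ _ (λ e → x≢y (to-injective e)) eq))
    , (λ x y fx fy → trans (preserve φ x y) (no-back _ _ fx fy))
    , (λ x fx → let y , fy , xy = F-out (to φ x) fx in from φ y , trans (cong inF (to∘from φ y)) fy ,
        trans (preserve φ x (from φ y)) (trans (cong (arc E (to φ x)) (to∘from φ y)) xy))
    , (λ y fy → let x , fx , xy = B-in (to φ y) fy in from φ x , trans (cong inF (to∘from φ x)) fx ,
        trans (preserve φ (from φ x) y) (trans (cong (λ z → arc E z (to φ y)) (to∘from φ x)) xy))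
    where
    to-injective : ∀ {x y} → to φ x ≡ to φ y → x ≡ y
    to-injective eq = trans (sym (from∘to φ _)) (trans (cong (from φ) eq) (from∘to φ _))

Outcome₃ : ∀ {p} → Digraph p → Set
Outcome₃ {p} D = HasC3 D ⊎ (InB (p / 2) D ⊎ (D ≅ Q5*) ⊎ (D ≅ Kstar (p / 2) (suc (p / 2))))

Outcome₄ : ∀ {p} → Digraph p → Set
Outcome₄ D = HasC4 D ⊎ (InH 3 D ⊎ (D ≅ Q5*) ⊎ (D ≅ H'6) ⊎ (D ≅ H''6) ⊎ (D ≅ H'''6) ⊎ (D ≅ K2K2K1*))

transport₃ : ∀ {p} {D E : Digraph p} → D ≅ E → Outcome₃ E → Outcome₃ D
transport₃ φ = Sum.map (Transport.C3 φ)
  (Sum.map (λ (3≤n , M , dis , iso) → 3≤n , M , dis , ≅-trans φ iso) (Sum.map (≅-trans φ) (≅-trans φ)))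

transport₄ : ∀ {p} {D E : Digraph p} → D ≅ E → Outcome₄ E → Outcome₄ D
transport₄ φ = Sum.map (Transport.C4 φ) (Sum.map (Transport.H φ) (Sum.map (≅-trans φ) (Sum.map (≅-trans φ)
  (Sum.map (≅-trans φ) (Sum.map (≅-trans φ) (≅-trans φ))))))

-- Sound Boolean tests and backtracking.

any-sound : ∀ {A : Set} (f : A → Bool) xs → any f xs ≡ true → ∃[ x ] f x ≡ true
any-sound f (x ∷ xs) h with f x in fx
... | true  = x , fx
... | false = any-sound f xs h

anyF allF : ∀ {n} → (Fin n → Bool) → Bool
anyF {zero}  f = false
anyF {suc n} f = f fzero ∨ anyF (f ∘ fsuc)
allF {zero}  f = true
allF {suc n} f = f fzero ∧ allF (f ∘ fsuc)

anyF-sound : ∀ {n} (f : Fin n → Bool) → anyF f ≡ true → ∃[ x ] f x ≡ true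
anyF-sound {suc n} f h = [ (λ fx → fzero , fx) , (λ h → let x , fx = anyF-sound (f ∘ fsuc) h in fsuc x , fx) ] (∨-elim h)

allF-sound : ∀ {n} (f : Fin n → Bool) → allF f ≡ true → ∀ x → f x ≡ true
allF-sound f h fzero    = proj₁ (∧-elim h)
allF-sound f h (fsuc x) = allF-sound (f ∘ fsuc) (proj₂ (∧-elim {f fzero} h)) x

does-sound : ∀ {P : Set} (P? : Dec P) → does P? ≡ true → P
does-sound (yes p) _ = p

-- A one-sided decision: success yields a proof, failure says nothing. A search for a labelling thus
-- needs soundness alone.
record Test (P : Set) : Set where
  constructor _because_
  field
    passes : Bool
    sound  : passes ≡ true → P
open Test

infixr 1 _or_
_or_ : ∀ {P Q : Set} → Test P → Test Q → Test (P ⊎ Q)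
(false because _) or (q because qs) = q because λ h → inj₂ (qs h)
(true  because ps) or _             = true because λ h → inj₁ (ps h)

weaken : ∀ {P Q : Set} → (P → Q) → Test P → Test Q
weaken f (p because ps) = p because λ h → f (ps h)

-- Labellings of the vertices are found by backtracking, and only complete labellings are verified.
module Backtracking {p : ℕ} {V : Set} (labels : List V)
  (compatible : Fin p → V → Fin p × V → Bool) (accept : List (Fin p × V) → Bool) where

  extend : List (Fin p) → List (Fin p × V) → Bool
  extend []       σ = accept σ
  extend (x ∷ xs) σ = any (λ v → all (compatible x v) σ ∧ extend xs ((x , v) ∷ σ)) labels

  extend-sound : ∀ xs σ → extend xs σ ≡ true → ∃[ τ ] accept τ ≡ true
  extend-sound []       σ h = σ , h
  extend-sound (x ∷ xs) σ h = let v , hv = any-sound _ labels h in extend-sound xs _ (proj₂ (∧-elim hv))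

-- The default only makes the function total. Whatever function results is checked in full before a
-- labelling is accepted.
assoc : ∀ {p} {V : Set} → V → List (Fin p × V) → Fin p → V
assoc d []            x = d
assoc d ((y , v) ∷ σ) x = if does (x ≟ y) then v else assoc d σ x

module Isomorphism {p : ℕ} (D E : Digraph (suc p)) where

  private
    Σ-map : Set
    Σ-map = List (Fin (suc p) × Fin (suc p))

    forward backward : Σ-map → Fin (suc p) → Fin (suc p)
    forward    = assoc fzero
    backward σ = assoc fzero (List.map (λ (x , y) → y , x) σ)

    compatible : Fin (suc p) → Fin (suc p) → Fin (suc p) × Fin (suc p) → Bool
    compatible x v (y , w) = not (does (v ≟ w)) ∧
      does (arc D x y Bool.≟ arc E v w) ∧ does (arc D y x Bool.≟ arc E w v)

    isIso? : (σ : Σ-map) → Dec ((∀ x → backward σ (forward σ x) ≡ x) × (∀ y → forward σ (backward σ y) ≡ y) ×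
      (∀ x y → arc D x y ≡ arc E (forward σ x) (forward σ y)))
    isIso? σ = all? (λ x → backward σ (forward σ x) ≟ x) ×-dec all? (λ y → forward σ (backward σ y) ≟ y) ×-dec
      all? (λ x → all? λ y → arc D x y Bool.≟ arc E (forward σ x) (forward σ y))

    module S = Backtracking (allFin (suc p)) compatible (does ∘ isIso?)

  isomorphic : Test (D ≅ E)
  isomorphic = S.extend (allFin (suc p)) [] because λ h →
    let σ , hσ = S.extend-sound (allFin (suc p)) [] h
        bf , fb , pres = does-sound (isIso? σ) hσ
    in record { to = forward σ ; from = backward σ ; from∘to = bf ; to∘from = fb ; preserve = pres }

module MembershipInH {p : ℕ} (n : ℕ) (D : Digraph p) where

  private
    compatible : Fin p → Bool → Fin p × Bool → Bool
    compatible x true  (y , true)  = arc D x y ∧ arc D y x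
    compatible x true  (y , false) = not (arc D y x)
    compatible x false (y , true)  = not (arc D x y)
    compatible x false (y , false) = arc D x y ∧ arc D y x

    isH? : (σ : List (Fin p × Bool)) → let inF = assoc false σ in Dec (
      (count inF ≡ n) × (count (λ x → not (inF x)) ≡ n) ×
      (∀ x y → x ≢ y → inF x ≡ inF y → arc D x y ≡ true) ×
      (∀ x y → inF x ≡ false → inF y ≡ true → arc D x y ≡ false) ×
      (∀ x → inF x ≡ true → Σ (Fin p) λ y → (inF y ≡ false) × (arc D x y ≡ true)) ×
      (∀ y → inF y ≡ false → Σ (Fin p) λ x → (inF x ≡ true) × (arc D x y ≡ true)))
    isH? σ = let inF = assoc false σ in
      (count inF ℕ.≟ n) ×-dec (count (λ x → not (inF x)) ℕ.≟ n) ×-dec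
      all? (λ x → all? λ y → ¬? (x ≟ y) →-dec (inF x Bool.≟ inF y) →-dec (arc D x y Bool.≟ true)) ×-dec
      all? (λ x → all? λ y → (inF x Bool.≟ false) →-dec (inF y Bool.≟ true) →-dec (arc D x y Bool.≟ false)) ×-dec
      all? (λ x → (inF x Bool.≟ true) →-dec any? λ y → (inF y Bool.≟ false) ×-dec (arc D x y Bool.≟ true)) ×-dec
      all? (λ y → (inF y Bool.≟ false) →-dec any? λ x → (inF x Bool.≟ true) ×-dec (arc D x y Bool.≟ true))

    module S = Backtracking (true ∷ false ∷ []) compatible (does ∘ isH?)

  inH : Test (InH n D)
  inH = S.extend (allFin p) [] because λ h →
    let σ , hσ = S.extend-sound (allFin p) [] h in assoc false σ , does-sound (isH? σ) hσ

-- The entry nothing marks a pair whose arc is still undecided.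
Partial : ℕ → Set
Partial p = Vec (Vec (Maybe Bool) p) p

entry : ∀ {p} → Partial p → Fin p → Fin p → Maybe Bool
entry K x y = lookup (lookup K x) y

_⊑_ : ∀ {p} → Partial p → Digraph p → Set
K ⊑ D = ∀ x y {b} → entry K x y ≡ just b → arc D x y ≡ b

assign : ∀ {p} → Fin p → Fin p → Bool → Partial p → Partial p
assign x y b K = updateAt K x (λ row → updateAt row y (const (just b)))

assign-⊑ : ∀ {p} {D : Digraph p} {K x y b} → K ⊑ D → arc D x y ≡ b → assign x y b K ⊑ D
assign-⊑ {K = K} {x} {y} {b} K⊑D xy u v eq with u ≟ x
... | no u≢x = K⊑D u v (trans (cong (λ r → lookup r v) (sym (lookup∘updateAt′ u x u≢x K))) eq)
... | yes refl with v ≟ y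
...   | yes refl = trans xy (just-injective (trans (sym (lookup∘updateAt y (lookup K x)))
                     (trans (cong (λ r → lookup r y) (sym (lookup∘updateAt x K))) eq)))
...   | no v≢y   = K⊑D x v (trans (sym (lookup∘updateAt′ v y v≢y (lookup K x)))
                     (trans (cong (λ r → lookup r v) (sym (lookup∘updateAt x K))) eq))

unknown : ∀ p → Partial p
unknown p = tabulate λ x → tabulate λ y → if does (x ≟ y) then just false else nothing

unknown-⊑ : ∀ {p} (D : Digraph p) → unknown p ⊑ D
unknown-⊑ {p} D x y eq with trans (sym (trans (cong (λ r → lookup r y) (lookup∘tabulate _ x)) (lookup∘tabulate _ y))) eq
... | eq′ with x ≟ y
...   | yes refl = trans (noLoop D x) (just-injective eq′)

-- If K ⊑ D, the present pairs bound the arcs of D from below and the possible pairs from above.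
-- Forced cycles are read off the former, upper bounds for degrees off the latter.
present possible determined : Maybe Bool → Bool
present    (just true)  = true
present    _            = false
possible   (just false) = false
possible   _            = true
determined nothing      = false
determined (just _)     = true

present-sound : ∀ {m} → present m ≡ true → m ≡ just true
present-sound {just true} _ = refl

possible-complete : ∀ {m} → possible m ≡ false → m ≡ just false
possible-complete {just false} _ = refl

determined-sound : ∀ {m} → determined m ≡ true → m ≡ just (present m)
determined-sound {just true}  _ = refl
determined-sound {just false} _ = refl

completion : ∀ {p} → Partial p → Digraph p
completion K = loopless λ x y → present (entry K x y)

≅-completion : ∀ {p} {K : Partial p} {D} → K ⊑ D → (∀ x y → determined (entry K x y) ≡ true) → D ≅ completion K
≅-completion {K = K} {D} K⊑D det = record
  { to = λ x → x ; from = λ x → x ; from∘to = λ _ → refl ; to∘from = λ _ → refl ; preserve = agree }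
  where
  agree : ∀ x y → arc D x y ≡ arc (completion K) x y
  agree x y with x ≟ y
  ... | yes refl = noLoop D x
  ... | no  _    = K⊑D x y (determined-sound (det x y))

module _ {p : ℕ} (K : Partial p) where

  closes-C3 : Fin p → Fin p → Bool
  closes-C3 x y = anyF λ z → present (entry K y z) ∧ present (entry K z x)

  closes-C4 : Fin p → Fin p → Bool
  closes-C4 x y = anyF λ z → present (entry K y z) ∧ not (does (x ≟ z)) ∧
    anyF λ w → present (entry K w x) ∧ present (entry K z w) ∧ not (does (y ≟ w))

  maxOut maxIn : Fin p → ℕ
  maxOut x = count λ y → possible (entry K x y)
  maxIn  x = count λ y → possible (entry K y x)

  -- The negation of one of the conditions of `Dense`, at the largest degrees x can still attain; no
  -- dense digraph then extends K.
  sparse : Fin p → Bool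
  sparse x = let o = maxOut x ; i = maxIn x in
    (2 * i + 2 <ᵇ p) ∨ (2 * o + 2 <ᵇ p) ∨ (suc (i + o) <ᵇ p)

  module _ {D : Digraph p} (K⊑D : K ⊑ D) where

    present-arc : ∀ {x y} → present (entry K x y) ≡ true → arc D x y ≡ true
    present-arc h = K⊑D _ _ (present-sound h)

    possible-arc : ∀ {x y} → arc D x y ≡ true → possible (entry K x y) ≡ true
    possible-arc xy = Bool.¬-not λ h → true≢false xy (K⊑D _ _ (possible-complete h))

    closes-C3-sound : ∀ {x y} → arc D x y ≡ true → closes-C3 x y ≡ true → HasC3 D
    closes-C3-sound {x} {y} xy h =
      let z , hz = anyF-sound _ h
          yz , zx = ∧-elim {present (entry K y z)} hz
      in triangle D xy (present-arc yz) (present-arc zx)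

    closes-C4-sound : ∀ {x y} → arc D x y ≡ true → closes-C4 x y ≡ true → HasC4 D
    closes-C4-sound {x} {y} xy h =
      let z , hz = anyF-sound _ h
          yz , hz = ∧-elim {present (entry K y z)} hz
          x≢z , hz = ∧-elim {not (does (x ≟ z))} hz
          w , hw = anyF-sound _ hz
          wx , hw = ∧-elim {present (entry K w x)} hw
          zw , y≢w = ∧-elim {present (entry K z w)} hw
      in quadrangle D (differ x≢z) (differ y≢w) xy (present-arc yz) (present-arc zw) (present-arc wx)
      where
      differ : ∀ {a b : Fin p} → not (does (a ≟ b)) ≡ true → a ≢ b
      differ {a} h refl = true≢false (dec-true (a ≟ a) refl) (not-true h)

    sparse-sound : Dense D → ∀ {x} → sparse x ≡ true → ⊥
    sparse-sound dense {x} h =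
      [ (λ h → <⇒≱ (<ᵇ⇒< _ _ (T-true h)) (≤-trans (in≥ dense x) (+-monoˡ-≤ 2 (*-monoʳ-≤ 2 in≤))))
      , (λ h → [ (λ h → <⇒≱ (<ᵇ⇒< _ _ (T-true h)) (≤-trans (out≥ dense x) (+-monoˡ-≤ 2 (*-monoʳ-≤ 2 out≤))))
               , (λ h → <⇒≱ (<ᵇ⇒< _ _ (T-true h)) (≤-trans (total≥ dense x) (s≤s (+-mono-≤ in≤ out≤))))
               ] (∨-elim {2 * maxOut x + 2 <ᵇ p} h))
      ] (∨-elim {2 * maxIn x + 2 <ᵇ p} h)
      where
      T-true : ∀ {b} → b ≡ true → T b
      T-true = Equivalence.from Bool.T-≡
      out≤ : outdeg D x ≤ maxOut x
      out≤ = count-mono (arc D x) (λ y → possible (entry K x y)) λ y → possible-arc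
      in≤ : indeg D x ≤ maxIn x
      in≤ = count-mono (λ y → arc D y x) (λ y → possible (entry K y x)) λ y → possible-arc

-- Exhaustive branching over undecided arcs.

module Search {p : ℕ} (Goal : Digraph p → Set) (transport : ∀ {D E} → D ≅ E → Goal E → Goal D)
  (closes : Partial p → Fin p → Fin p → Bool)
  (closes-sound : ∀ {K D x y} → K ⊑ D → arc D x y ≡ true → closes K x y ≡ true → Goal D)
  (recognise : ∀ D → Test (Goal D)) where

  search : List (Fin p × Fin p) → Partial p → Bool
  branch : Maybe Bool → Fin p → Fin p → List (Fin p × Fin p) → Partial p → Bool
  -- Testing that every entry is decided replaces a proof that the list contains all pairs.
  search []             K = allF (λ x → allF λ y → determined (entry K x y)) ∧ passes (recognise (completion K))
  search ((x , y) ∷ vs) K = branch (entry K x y) x y vs K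
  -- This skips arcs fixed in advance, such as those of the assumed triangle.
  branch (just _) x y vs K = search vs K
  branch nothing  x y vs K =
    -- A new arc may complete a cycle, which settles the branch; an absent arc can violate a degree
    -- bound only at its two ends.
    (closes K x y ∨ search vs (assign x y true K)) ∧
    (let K′ = assign x y false K in sparse K′ x ∨ sparse K′ y ∨ search vs K′)

  -- At each undecided pair D itself selects the branch that still describes it. The path ends in a
  -- cycle, in a contradiction to density, or in a completion isomorphic to D that is recognised.
  search-sound : ∀ vs K → search vs K ≡ true → ∀ {D} → Dense D → K ⊑ D → Goal D
  branch-sound : ∀ m x y vs K → branch m x y vs K ≡ true → ∀ {D} → Dense D → K ⊑ D → Goal D
  search-sound [] K h dense K⊑D =
    let det , acc = ∧-elim h in
    transport (≅-completion {K = K} K⊑D λ x y → allF-sound _ (allF-sound _ det x) y) (sound (recognise (completion K)) acc)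
  search-sound ((x , y) ∷ vs) K h = branch-sound (entry K x y) x y vs K h
  branch-sound (just _) x y vs K h = search-sound vs K h
  branch-sound nothing x y vs K h {D} dense K⊑D with arc D x y in xy
  ... | true  = [ closes-sound K⊑D xy , (λ s → search-sound vs _ s dense (assign-⊑ {D = D} {K = K} K⊑D xy)) ]
                  (∨-elim {closes K x y} (proj₁ (∧-elim h)))
  ... | false =
    let K′ = assign x y false K
        K′⊑D = assign-⊑ {D = D} {K = K} K⊑D xy
        contra = λ {x} s → ⊥-elim (sparse-sound K′ K′⊑D dense {x} s)
    in [ contra , (λ h → [ contra , (λ s → search-sound vs K′ s dense K′⊑D) ] (∨-elim {sparse K′ y} h)) ]
         (∨-elim {sparse K′ x} (proj₂ (∧-elim {closes K x y ∨ search vs (assign x y true K)} h)))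

-- All arcs among the first k vertices are decided before any arc at the next vertex.
pairs : ∀ p → List (Fin p × Fin p)
pairs p = List.concatMap (λ k → List.concatMap (λ l → if toℕ l <ᵇ toℕ k then (l , k) ∷ (k , l) ∷ [] else []) (allFin p)) (allFin p)

-- Each of the three recognisers tries just the exceptions of the order at hand; B(n,n) starts at
-- order 6 and is absent here.
recognise₃ : ∀ D → Test (Outcome₃ {5} D)
recognise₃ D = weaken (inj₂ ∘ inj₂) (isomorphic D Q5* or isomorphic D (Kstar 2 3))
  where open Isomorphism

recognise₄ : ∀ D → Test (Outcome₄ {5} D)
recognise₄ D = weaken (inj₂ ∘ inj₂ ∘ Sum.map₂ (inj₂ ∘ inj₂ ∘ inj₂)) (isomorphic D Q5* or isomorphic D K2K2K1*)
  where open Isomorphism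

recognise₆ : ∀ D → Test (Outcome₄ {6} D)
recognise₆ D = weaken (inj₂ ∘ Sum.map₂ (inj₂ ∘ Sum.map₂ (Sum.map₂ inj₁)))
  (MembershipInH.inH 3 D or isomorphic D H'6 or isomorphic D H''6 or isomorphic D H'''6)
  where open Isomorphism

module Search₃ = Search {5} Outcome₃ transport₃ closes-C3 (λ {K} {D} K⊑D xy → inj₁ ∘ closes-C3-sound K {D} K⊑D xy) recognise₃
module Search₄ = Search {5} Outcome₄ transport₄ closes-C4 (λ {K} {D} K⊑D xy → inj₁ ∘ closes-C4-sound K {D} K⊑D xy) recognise₄
module Search₆ = Search {6} Outcome₄ transport₄ closes-C4 (λ {K} {D} K⊑D xy → inj₁ ∘ closes-C4-sound K {D} K⊑D xy) recognise₆

-- Moving a triangle to the vertices 0, 1, 2.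

private
  transpose-matchˡ : ∀ {n} (i j : Fin n) → transpose i j ⟨$⟩ʳ i ≡ j
  transpose-matchˡ i j rewrite dec-true (i ≟ i) refl = refl

  transpose-mismatch : ∀ {n} {i j k : Fin n} → k ≢ i → k ≢ j → transpose i j ⟨$⟩ʳ k ≡ k
  transpose-mismatch {i = i} {j} {k} k≢i k≢j rewrite dec-false (k ≟ i) k≢i | dec-false (k ≟ j) k≢j = refl

-- Before π is applied, i is swapped with the current preimage of c. This sends i to c and disturbs
-- at most one other value.
redirect : ∀ {n} → Permutation′ n → Fin n → Fin n → Permutation′ n
redirect π i c = transpose i (π ⟨$⟩ˡ c) ∘ₚ π

redirect-self : ∀ {n} (π : Permutation′ n) i c → redirect π i c ⟨$⟩ʳ i ≡ c
redirect-self π i c = trans (cong (π ⟨$⟩ʳ_) (transpose-matchˡ i (π ⟨$⟩ˡ c))) (inverseʳ π)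

redirect-other : ∀ {n} (π : Permutation′ n) {i c k} → k ≢ i → π ⟨$⟩ʳ k ≢ c → redirect π i c ⟨$⟩ʳ k ≡ π ⟨$⟩ʳ k
redirect-other π k≢i πk≢c = cong (π ⟨$⟩ʳ_)
  (transpose-mismatch k≢i λ k≡ → πk≢c (trans (cong (π ⟨$⟩ʳ_) k≡) (inverseʳ π)))

-- The identity is redirected three times. As sources and targets are distinct, later redirections
-- keep the earlier values.
three-point-transitive : ∀ {n} {i j k a b c : Fin n} → i ≢ j → i ≢ k → j ≢ k → a ≢ b → a ≢ c → b ≢ c →
  ∃[ π ] π ⟨$⟩ʳ i ≡ a × π ⟨$⟩ʳ j ≡ b × π ⟨$⟩ʳ k ≡ c
three-point-transitive {n} {i} {j} {k} {a} {b} {c} i≢j i≢k j≢k a≢b a≢c b≢c =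
  π₃ , trans (redirect-other π₂ i≢k (λ e → a≢c (trans (sym at-i) e))) at-i
     , trans (redirect-other π₂ j≢k (λ e → b≢c (trans (sym at-j) e))) at-j
     , redirect-self π₂ k c
  where
  π₁ π₂ π₃ : Permutation′ n
  π₁ = redirect idₚ i a
  π₂ = redirect π₁ j b
  π₃ = redirect π₂ k c
  at-i : π₂ ⟨$⟩ʳ i ≡ a
  at-i = trans (redirect-other π₁ i≢j (λ e → a≢b (trans (sym (redirect-self idₚ i a)) e))) (redirect-self idₚ i a)
  at-j : π₂ ⟨$⟩ʳ j ≡ b
  at-j = redirect-self π₁ j b

relabel : ∀ {p} → Permutation′ p → Digraph p → Digraph p
relabel π D = record { arc = λ x y → arc D (π ⟨$⟩ʳ x) (π ⟨$⟩ʳ y) ; noLoop = λ x → noLoop D (π ⟨$⟩ʳ x) }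

≅-relabel : ∀ {p} (π : Permutation′ p) (D : Digraph p) → D ≅ relabel π D
≅-relabel π D = record
  { to       = π ⟨$⟩ˡ_
  ; from     = π ⟨$⟩ʳ_
  ; from∘to  = λ _ → inverseʳ π
  ; to∘from  = λ _ → inverseˡ π
  ; preserve = λ _ _ → sym (cong₂ (arc D) (inverseʳ π) (inverseʳ π))
  }

relabel-dense : ∀ {p} (π : Permutation′ p) {D : Digraph p} → Dense D → Dense (relabel π D)
relabel-dense {p} π {D} dense = record
  { total≥ = λ x → subst₂ (λ i o → p ≤ suc (i + o)) (in≡ x) (out≡ x) (total≥ dense (π ⟨$⟩ʳ x))
  ; in≥    = λ x → subst (λ i → p ≤ 2 * i + 2) (in≡ x) (in≥ dense (π ⟨$⟩ʳ x))
  ; out≥   = λ x → subst (λ o → p ≤ 2 * o + 2) (out≡ x) (out≥ dense (π ⟨$⟩ʳ x))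
  }
  where
  in≡ : ∀ x → indeg D (π ⟨$⟩ʳ x) ≡ indeg (relabel π D) x
  in≡ x = count-permute (λ y → arc D y (π ⟨$⟩ʳ x)) π
  out≡ : ∀ x → outdeg D (π ⟨$⟩ʳ x) ≡ outdeg (relabel π D) x
  out≡ x = count-permute (arc D (π ⟨$⟩ʳ x)) π

triangle-only : Partial 6
triangle-only = assign 0F 1F true (assign 1F 2F true (assign 2F 0F true (unknown 6)))

abstract
  order-5-C3 : {D : Digraph 5} → Dense D → unknown 5 ⊑ D → Outcome₃ D
  -- In this and the next two proofs `refl` stands for the evaluation of the entire search to
  -- `true`.
  order-5-C3 = Search₃.search-sound (pairs 5) (unknown 5) refl

  order-5-C4 : {D : Digraph 5} → Dense D → unknown 5 ⊑ D → Outcome₄ D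
  order-5-C4 = Search₄.search-sound (pairs 5) (unknown 5) refl

  order-6-C4 : {D : Digraph 6} → Dense D → triangle-only ⊑ D → Outcome₄ D
  order-6-C4 = Search₆.search-sound (pairs 6) triangle-only refl

order-5 : {D : Digraph 5} → Dense D → Outcome₃ D × Outcome₄ D
order-5 {D} dense = order-5-C3 dense (unknown-⊑ D) , order-5-C4 dense (unknown-⊑ D)

triangle-only-⊑ : {D : Digraph 6} → arc D 0F 1F ≡ true → arc D 1F 2F ≡ true → arc D 2F 0F ≡ true → triangle-only ⊑ D
triangle-only-⊑ {D} e₀₁ e₁₂ e₂₀ =
  assign-⊑ {D = D} {K = K₁₂} (assign-⊑ {D = D} {K = K₂₀} (assign-⊑ {D = D} {K = unknown 6} (unknown-⊑ D) e₂₀) e₁₂) e₀₁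
  where
  K₂₀ K₁₂ : Partial 6
  K₂₀ = assign 2F 0F true (unknown 6)
  K₁₂ = assign 1F 2F true K₂₀

order-6-with-triangle : {D : Digraph 6} → Dense D → HasC3 D → Outcome₄ D
order-6-with-triangle {D} dense (a , b , c , a≢b , b≢c , a≢c , ab , bc , ca) =
  let π , π0 , π1 , π2 = three-point-transitive {i = 0F} {1F} {2F} (λ ()) (λ ()) (λ ()) a≢b a≢c b≢c
  in transport₄ (≅-relabel π D) (order-6-C4 (relabel-dense π dense) (triangle-only-⊑ {relabel π D}
       (trans (cong₂ (arc D) π0 π1) ab) (trans (cong₂ (arc D) π1 π2) bc) (trans (cong₂ (arc D) π2 π0) ca)))

-- Assembling the cases by order.

outcome₃ : ∀ {p} {D : Digraph p} → Dense D → 6 ≤ p → Outcome₃ D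
outcome₃ {suc _} {D} dense 6≤p with hasC3? D
... | yes c3  = inj₁ c3
... | no noC3 = inj₂ (Sum.map₂ inj₂ (bipartite-classification dense 6≤p (proj₂ (C3Free.proper-colouring dense 6≤p noC3 fzero))))

outcome₄ : ∀ {p} {D : Digraph p} → Dense D → 6 ≤ p → Outcome₄ D
outcome₄ {p} {D} dense 6≤p with m≤n⇒m<n∨m≡n 6≤p
... | inj₁ 7≤p  = inj₁ (C4-of-7≤p dense 7≤p)
... | inj₂ refl with hasC3? D
...   | yes c3  = order-6-with-triangle dense c3
...   | no noC3 = inj₁ (Coloured.C4-of-6≤p dense (proj₂ (C3Free.proper-colouring dense 6≤p noC3 fzero)) 6≤p)

theorem4p3 : (p : ℕ) (D : Digraph p) → 5 ≤ p →
    (∀ x → p ∸ 1 ≤ indeg D x + outdeg D x) →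
    (∀ x → p ≤ 2 * indeg D x + 2) →
    (∀ x → p ≤ 2 * outdeg D x + 2) →
    (HasC3 D ⊎ (InB (p / 2) D ⊎ (D ≅ Q5*) ⊎ (D ≅ Kstar (p / 2) (suc (p / 2)))))
    × (HasC4 D ⊎ (InH 3 D ⊎ (D ≅ Q5*) ⊎ (D ≅ H'6) ⊎ (D ≅ H''6) ⊎ (D ≅ H'''6) ⊎ (D ≅ K2K2K1*)))
theorem4p3 p D 5≤p total in≥ out≥ with m≤n⇒m<n∨m≡n 5≤p
... | inj₁ 6≤p  = outcome₃ dense 6≤p , outcome₄ dense 6≤p
  where
  dense : Dense D
  dense = record { total≥ = λ x → ≤-trans (m≤n+m∸n p 1) (s≤s (total x)) ; in≥ = in≥ ; out≥ = out≥ }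
... | inj₂ refl = order-5 (record { total≥ = λ x → s≤s (total x) ; in≥ = in≥ ; out≥ = out≥ })
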